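{- For every $\epsilon>0$ there is $\eta>0$ such that for all sufficiently large $n$ the following holds. If $H$ is a $4$-uniform hypergraph on $n$ vertices containing no copy of ${\cal C}^{(4)}_3$ with $e(H)>b(n)-\eta n^4$, then there is a partition $V(H)=V_1\cup V_2$ such that all but at most $\epsilon n^4$ of the $4$-element subsets of $V(H)$ are correct with respect to this partition.
   Context: ${\cal C}^{(4)}_3$ is the $4$-uniform hypergraph with vertices $a,b,c,d,e,f$ and the three edges $abcd, abef, cdef$. For $n$ and $t$ with $n/2+t$ a nonnegative integer and $|t|\le n/2$, ${\cal B}(n,t)$ is the $4$-uniform hypergraph on $n$ vertices partitioned into parts of sizes $n/2+t$ and $n/2-t$ whose edges are all $4$-sets having exactly $1$ vertex in one part and $3$ in the other; $b(n)$ is the maximum over admissible $t$ of the number of edges of ${\cal B}(n,t)$. Given a partition $V(H)=V_1\cup V_2$, a $4$-set is good if it has $1$ point in one of $V_1,V_2$ and $3$ in the other, and bad otherwise; it is correct (with respect to $H$) if it is either a good edge of $H$ or a bad non-edge of $H$, and incorrect otherwise. -}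

module Defs where

open import Data.Bool.Properties using () renaming (_≟_ to _≟ᵇ_)
open import Data.Fin using (Fin; zero; suc; toℕ)
open import Data.Fin.Subset
  using (Subset; inside; outside; ⊥; ⁅_⁆; ∁; _∩_; _∪_; ∣_∣)
open import Data.Integer using (+_)
open import Data.List using (List; []; _∷_; _++_; map; filter; length; upTo)
open import Data.List.Extrema.Nat using (max)
open import Data.Nat using (ℕ; zero; suc; _<?_; _≟_)
open import Data.Product using (Σ-syntax; _×_; proj₁)
open import Data.Rational using (ℚ; _/_)
open import Data.Sum using (_⊎_; inj₁; inj₂)
open import Data.Vec using ([]; _∷_; tabulate)
open import Data.Vec.Properties using (≡-dec)
open import Function using (_∘_)
open import Function.Definitions using (Injective)
open import Level using (0ℓ)
open import Relation.Binary.PropositionalEquality using (_≡_; refl)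
open import Relation.Nullary using (¬_; does)
open import Relation.Nullary.Decidable using (_×-dec_; _⊎-dec_; ¬?)
open import Relation.Unary using (Pred; Decidable)

fromℕ : ℕ → ℚ
fromℕ n = + n / 1

subsets : ∀ n → List (Subset n)
subsets zero    = [] ∷ []
subsets (suc n) = map (inside ∷_) (subsets n) ++ map (outside ∷_) (subsets n)

count : ∀ {n} {P : Pred (Subset n) 0ℓ} → Decidable P → ℕ
count {n} P? = length (filter P? (subsets n))

image : ∀ {m n} → (Fin m → Fin n) → Subset m → Subset n
image f []            = ⊥
image f (inside  ∷ S) = ⁅ f zero ⁆ ∪ image (f ∘ suc) S
image f (outside ∷ S) = image (f ∘ suc) S

-- r-uniform hypergraphs with vertex set Fin n.  Decidability of the edge
-- predicate makes the edge set a finite set that can be counted.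
record Hypergraph (r n : ℕ) : Set₁ where
  field
    Edge    : Pred (Subset n) 0ℓ
    edge?   : Decidable Edge
    uniform : ∀ {S} → Edge S → ∣ S ∣ ≡ r

open Hypergraph public

e : ∀ {r n} → Hypergraph r n → ℕ
e H = count (edge? H)

-- Copies are not required to be induced.
Contains : ∀ {r m n} → Hypergraph r n → Hypergraph r m → Set
Contains {m = m} {n} H F =
  Σ[ f ∈ (Fin m → Fin n) ]
    Injective _≡_ _≡_ f × (∀ S → Edge F S → Edge H (image f S))

-- The vertices a, b, c, d, e, f are 0, …, 5 in this order.
abcd abef cdef : Subset 6
abcd = inside  ∷ inside  ∷ inside  ∷ inside  ∷ outside ∷ outside ∷ []
abef = inside  ∷ inside  ∷ outside ∷ outside ∷ inside  ∷ inside  ∷ []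
cdef = outside ∷ outside ∷ inside  ∷ inside  ∷ inside  ∷ inside  ∷ []

𝓒₃⁽⁴⁾ : Hypergraph 4 6
𝓒₃⁽⁴⁾ .Edge S  = S ≡ abcd ⊎ S ≡ abef ⊎ S ≡ cdef
𝓒₃⁽⁴⁾ .edge? S =
  ≡-dec _≟ᵇ_ S abcd ⊎-dec ≡-dec _≟ᵇ_ S abef ⊎-dec ≡-dec _≟ᵇ_ S cdef
𝓒₃⁽⁴⁾ .uniform (inj₁ refl)        = refl
𝓒₃⁽⁴⁾ .uniform (inj₂ (inj₁ refl)) = refl
𝓒₃⁽⁴⁾ .uniform (inj₂ (inj₂ refl)) = refl

-- Throughout, a partition V₁ ∪ V₂ of Fin n is given by V₁, with V₂ = ∁ V₁.

Good : ∀ {n} → Subset n → Pred (Subset n) 0ℓ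
Good V₁ S = ∣ S ∣ ≡ 4 ×
  ((∣ S ∩ V₁ ∣ ≡ 1 × ∣ S ∩ ∁ V₁ ∣ ≡ 3) ⊎ (∣ S ∩ V₁ ∣ ≡ 3 × ∣ S ∩ ∁ V₁ ∣ ≡ 1))

good? : ∀ {n} (V₁ : Subset n) → Decidable (Good V₁)
good? V₁ S = (∣ S ∣ ≟ 4) ×-dec
  (((∣ S ∩ V₁ ∣ ≟ 1) ×-dec (∣ S ∩ ∁ V₁ ∣ ≟ 3)) ⊎-dec
   ((∣ S ∩ V₁ ∣ ≟ 3) ×-dec (∣ S ∩ ∁ V₁ ∣ ≟ 1)))

firstVertices : ∀ n → ℕ → Subset n
firstVertices n k = tabulate (λ i → does (toℕ i <? k))

-- 𝓑 n k is 𝓑(n,t) for k = n/2 + t, so its parts have sizes k and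
-- n - k = n/2 - t; t may be a half-integer, but k is a natural number, and
-- ∣t∣ ≤ n/2 says exactly that k ≤ n.
𝓑 : ∀ n → ℕ → Hypergraph 4 n
𝓑 n k .Edge    = Good (firstVertices n k)
𝓑 n k .edge?   = good? (firstVertices n k)
𝓑 n k .uniform = proj₁

b : ℕ → ℕ
b n = max 0 (map (λ k → e (𝓑 n k)) (upTo (suc n)))

Correct : ∀ {n} → Hypergraph 4 n → Subset n → Pred (Subset n) 0ℓ
Correct H V₁ S = (Good V₁ S × Edge H S) ⊎ (¬ Good V₁ S × ¬ Edge H S)

correct? : ∀ {n} (H : Hypergraph 4 n) (V₁ : Subset n) → Decidable (Correct H V₁)
correct? H V₁ S =
  (good? V₁ S ×-dec edge? H S) ⊎-dec (¬? (good? V₁ S) ×-dec ¬? (edge? H S))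

incorrect4Sets : ∀ {n} → Hypergraph 4 n → Subset n → ℕ
incorrect4Sets H V₁ = count (λ S → (∣ S ∣ ≟ 4) ×-dec ¬? (correct? H V₁ S))

{-# OPTIONS --safe #-}
module Submission where

-- Call pairs ab and cd of vertices adjacent when abcd is an edge.  A triangle
-- in this graph on ordered pairs is a copy of 𝓒₃⁽⁴⁾, so Füredi's argument
-- applies: the neighbourhood of a pair of maximum degree is independent, and,
-- χ being its indicator, E(abcd) = χ(ab) + χ(cd) mod 2 up to few exceptions if
-- e(H) is almost n⁴/48, which is asymptotically b(n).  Adding up seven instances
-- of this congruence on the points x, y, a, b, c, d gives
--   E(abcd) = χ(xa) + χ(xb) + χ(xc) + χ(xd) mod 2,
-- and the right-hand side is 1 exactly if abcd is good for the partition
-- V₁ = { v : χ(xv) = 1 }.  A suitable x is found by averaging.  Sets of size 4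
-- are counted through ordered quadruples, each set arising 24 times.

open import Defs
open import Data.Bool using (Bool; true; false; not; _∧_; _∨_; _xor_)
import Data.Bool.Properties as Bool
open import Data.Bool.Solver using (module xor-∧-Solver)
open import Data.Fin using (Fin; zero; suc; toℕ)
open import Data.Fin.Properties using (all?)
open import Data.Fin.Subset using (Subset; inside; outside; ⊥; ⁅_⁆; ∁; _∩_; _∪_; ∣_∣)
open import Data.Fin.Subset.Properties using (∪-assoc; ∪-comm; ∪-identityˡ; ∣⊥∣≡0; ∩-zeroˡ)
import Data.Integer.Properties as ℤ
open import Data.List
  using (List; []; _∷_; _++_; map; filter; length; allFin; cartesianProduct; upTo)
open import Data.List.Extrema.Nat
  using (argmax; argmin; f[⊥]≤f[argmax]; f[xs]≤f[argmax]; f[argmin]≤f[⊤]; f[argmin]≤f[xs]; v≤max⁺)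
open import Data.List.Membership.Propositional using (lose)
open import Data.List.Membership.Propositional.Properties using (∈-map⁺; ∈-upTo⁺)
open import Data.List.Properties using (length-tabulate; map-tabulate)
open import Data.List.Relation.Unary.All as All using (All; []; _∷_)
open import Data.Nat
  using (ℕ; zero; suc; _+_; _*_; _^_; _!; _≤_; _<_; _<?_; z≤n; s≤s; ⌊_/2⌋; ⌈_/2⌉)
import Data.Nat.Coprimality as Coprime
open import Data.Nat.Properties
open import Data.Nat.Tactic.RingSolver using (solve-∀)
open import Data.Product using (Σ-syntax; ∃; _×_; _,_; proj₁; proj₂)
open import Data.Rational as ℚ using (ℚ; mkℚ; 0ℚ; toℚᵘ)
import Data.Rational.Properties as ℚ
open import Data.Rational.Unnormalised as ℚᵘ using (ℚᵘ; mkℚᵘ; *≤*)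
import Data.Rational.Unnormalised.Properties as ℚᵘ
open import Data.Sum as Sum using (_⊎_; inj₁; inj₂)
open import Data.Vec using (lookup; tabulate; []; _∷_)
open import Data.Vec.Properties using (lookup-map; lookup-zipWith; lookup∘tabulate)
open import Function using (_∘_)
open import Function.Definitions using (Injective)
open import Level using (0ℓ)
open import Relation.Binary.PropositionalEquality
open import Relation.Nullary using (¬_; Dec; does; yes; no; contradiction)
open import Relation.Nullary.Decidable using (from-yes; _×-dec_; ¬?)
open import Relation.Unary using (Pred; Decidable)

private variable
  A B : Set
  n : ℕ

-- Finite sums over lists.

⟦_⟧ : Bool → ℕ
⟦ true  ⟧ = 1
⟦ false ⟧ = 0

∑ : List A → (A → ℕ) → ℕ
∑ []       f = 0
∑ (x ∷ xs) f = f x + ∑ xs f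

infixr 6 ∑
syntax ∑ xs (λ x → t) = ∑[ x ∈ xs ] t

∑-cong : ∀ (xs : List A) {f g : A → ℕ} → (∀ x → f x ≡ g x) → ∑ xs f ≡ ∑ xs g
∑-cong []       eq = refl
∑-cong (x ∷ xs) eq = cong₂ _+_ (eq x) (∑-cong xs eq)

∑-mono : ∀ (xs : List A) {f g : A → ℕ} → (∀ x → f x ≤ g x) → ∑ xs f ≤ ∑ xs g
∑-mono []       le = z≤n
∑-mono (x ∷ xs) le = +-mono-≤ (le x) (∑-mono xs le)

∑-distrib-+ : ∀ (xs : List A) (f g : A → ℕ) →
  ∑[ x ∈ xs ] (f x + g x) ≡ ∑ xs f + ∑ xs g
∑-distrib-+ []       f g = refl
∑-distrib-+ (x ∷ xs) f g =
  trans (cong (f x + g x +_) (∑-distrib-+ xs f g)) (interchange (f x) (g x) _ _)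
  where
  interchange : ∀ a b c d → a + b + (c + d) ≡ a + c + (b + d)
  interchange = solve-∀

∑-distribˡ-* : ∀ (xs : List A) c (f : A → ℕ) → c * ∑ xs f ≡ ∑[ x ∈ xs ] c * f x
∑-distribˡ-* []       c f = *-zeroʳ c
∑-distribˡ-* (x ∷ xs) c f =
  trans (*-distribˡ-+ c (f x) _) (cong (c * f x +_) (∑-distribˡ-* xs c f))

∑-distribʳ-* : ∀ (xs : List A) c (f : A → ℕ) → ∑[ x ∈ xs ] f x * c ≡ ∑ xs f * c
∑-distribʳ-* []       c f = refl
∑-distribʳ-* (x ∷ xs) c f =
  trans (cong (f x * c +_) (∑-distribʳ-* xs c f)) (sym (*-distribʳ-+ c (f x) _))

∑-const : ∀ (xs : List A) c → ∑[ _ ∈ xs ] c ≡ length xs * c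
∑-const []       c = refl
∑-const (x ∷ xs) c = cong (c +_) (∑-const xs c)

∑-++ : ∀ (xs ys : List A) (f : A → ℕ) → ∑ (xs ++ ys) f ≡ ∑ xs f + ∑ ys f
∑-++ []       ys f = refl
∑-++ (x ∷ xs) ys f = trans (cong (f x +_) (∑-++ xs ys f)) (sym (+-assoc (f x) _ _))

∑-map : ∀ (h : A → B) (xs : List A) (f : B → ℕ) → ∑ (map h xs) f ≡ ∑ xs (f ∘ h)
∑-map h []       f = refl
∑-map h (x ∷ xs) f = cong (f (h x) +_) (∑-map h xs f)

∑-product : ∀ (xs : List A) (ys : List B) f g →
  ∑[ x ∈ xs ] ∑[ y ∈ ys ] f x * g y ≡ ∑ xs f * ∑ ys g
∑-product xs ys f g =
  trans (∑-cong xs λ x → sym (∑-distribˡ-* ys (f x) g)) (∑-distribʳ-* xs (∑ ys g) f)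

∑-comm : ∀ (xs : List A) (ys : List B) (f : A → B → ℕ) →
  ∑[ x ∈ xs ] ∑[ y ∈ ys ] f x y ≡ ∑[ y ∈ ys ] ∑[ x ∈ xs ] f x y
∑-comm []       ys f = sym (trans (∑-const ys 0) (*-zeroʳ (length ys)))
∑-comm (x ∷ xs) ys f =
  trans (cong (∑ ys (f x) +_) (∑-comm xs ys f)) (sym (∑-distrib-+ ys (f x) _))

∑-× : ∀ (xs : List A) (ys : List B) (f : A × B → ℕ) →
  ∑ (cartesianProduct xs ys) f ≡ ∑[ x ∈ xs ] ∑[ y ∈ ys ] f (x , y)
∑-× []       ys f = refl
∑-× (x ∷ xs) ys f =
  trans (∑-++ (map (x ,_) ys) _ f) (cong₂ _+_ (∑-map (x ,_) ys f) (∑-× xs ys f))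

∑-allFin : ∀ n (f : Fin (suc n) → ℕ) →
  ∑ (allFin (suc n)) f ≡ f zero + ∑ (allFin n) (f ∘ suc)
∑-allFin n f = cong (f zero +_)
  (trans (cong (λ xs → ∑ xs f) (sym (map-tabulate (λ i → i) suc))) (∑-map suc (allFin n) f))

tally : List A → (A → Bool) → ℕ
tally xs p = ∑ xs (⟦_⟧ ∘ p)

∑-∘-Bool : ∀ (xs : List A) (p : A → Bool) (G : Bool → ℕ) →
  ∑ xs (G ∘ p) ≡ tally xs p * G true + tally xs (not ∘ p) * G false
∑-∘-Bool []       p G = refl
∑-∘-Bool (x ∷ xs) p G with p x
... | true  = trans (cong (G true +_) (∑-∘-Bool xs p G)) (sym (+-assoc (G true) _ _))
... | false = trans (cong (G false +_) (∑-∘-Bool xs p G))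
  (rearrange (G false) (tally xs p * G true) (tally xs (not ∘ p) * G false))
  where
  rearrange : ∀ a b c → a + (b + c) ≡ b + (a + c)
  rearrange = solve-∀

tally-not : ∀ (xs : List A) (p : A → Bool) → tally xs p + tally xs (not ∘ p) ≡ length xs
tally-not []       p = refl
tally-not (x ∷ xs) p with p x
... | true  = cong suc (tally-not xs p)
... | false = trans (+-suc _ _) (cong suc (tally-not xs p))

-- A product bound and extremal elements of a list.

4mn≤[m+n]² : ∀ m n → 4 * (m * n) ≤ (m + n) * (m + n)
4mn≤[m+n]² m n with ≤-total m n
... | inj₁ m≤n with k , refl ← m≤n⇒∃[o]m+o≡n m≤n =
  ≤-trans (m≤m+n _ (k * k)) (≤-reflexive (square m k))
  where
  square : ∀ m k → 4 * (m * (m + k)) + k * k ≡ (m + (m + k)) * (m + (m + k))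
  square = solve-∀
... | inj₂ n≤m with k , refl ← m≤n⇒∃[o]m+o≡n n≤m =
  ≤-trans (m≤m+n _ (k * k)) (≤-reflexive (square n k))
  where
  square : ∀ n k → 4 * ((n + k) * n) + k * k ≡ (n + k + n) * (n + k + n)
  square = solve-∀

∃-max : ∀ (f : A → ℕ) x xs → ∃ λ y → All (λ z → f z ≤ f y) (x ∷ xs)
∃-max f x xs = argmax f x xs , f[⊥]≤f[argmax] {f = f} x xs ∷ f[xs]≤f[argmax] {f = f} x xs

∃-min : ∀ (f : A → ℕ) x xs → ∃ λ y → All (λ z → f y ≤ f z) (x ∷ xs)
∃-min f x xs = argmin f x xs , f[argmin]≤f[⊤] {f = f} x xs ∷ f[argmin]≤f[xs] {f = f} x xs

∑-mono-All : ∀ {xs : List A} {f g : A → ℕ} → All (λ x → f x ≤ g x) xs → ∑ xs f ≤ ∑ xs g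
∑-mono-All []         = z≤n
∑-mono-All (le ∷ les) = +-mono-≤ le (∑-mono-All les)

-- Füredi's stability argument for triangle-free graphs.

module Stability
  {A : Set} (xs : List A) (adj : A → A → Bool)
  (adj-sym : ∀ u v → adj u v ≡ adj v u)
  (triangle-free : ∀ u v w → ¬ (adj u v ≡ true × adj u w ≡ true × adj v w ≡ true))
  where

  N : ℕ
  N = length xs

  -- Split the vertices into the neighbours and the non-neighbours of p. The misplaced pairs are the
  -- edges inside a part and the non-edges between the parts.
  misplaced : A → A → A → Bool
  misplaced p u v = adj u v xor (adj p u xor adj p v)

  degree : A → ℕ
  degree u = tally xs (adj u)

  ∑² : (A → A → ℕ) → ℕ
  ∑² f = ∑[ u ∈ xs ] ∑ xs (f u)

  ∑²-+ : ∀ f g → ∑² (λ u v → f u v + g u v) ≡ ∑² f + ∑² g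
  ∑²-+ f g = trans (∑-cong xs λ u → ∑-distrib-+ xs (f u) (g u)) (∑-distrib-+ xs _ _)

  ∑²-* : ∀ c f → c * ∑² f ≡ ∑² (λ u v → c * f u v)
  ∑²-* c f = trans (∑-distribˡ-* xs c _) (∑-cong xs λ u → ∑-distribˡ-* xs c (f u))

  -- The right-hand side charges 1 to each pair between the parts, and 2 to an edge for each end
  -- outside the neighbourhood of p. An edge between the parts thus gets 1 + 2 = 3 and is not
  -- misplaced; an edge among the non-neighbours gets 4 = 1 + 3 and is misplaced. Triangle-freeness
  -- rules out edges among the neighbours.
  pointwise : ∀ p u v →
    ⟦ misplaced p u v ⟧ + 3 * ⟦ adj u v ⟧ ≡
    (⟦ adj p u ⟧ * ⟦ not (adj p v) ⟧ + ⟦ not (adj p u) ⟧ * ⟦ adj p v ⟧) +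
    (2 * (⟦ not (adj p u) ⟧ * ⟦ adj u v ⟧) + 2 * (⟦ not (adj p v) ⟧ * ⟦ adj v u ⟧))
  pointwise p u v rewrite adj-sym v u
    with adj p u in pu | adj p v in pv | adj u v in uv
  ... | true  | true  | true  = contradiction (pu , pv , uv) (triangle-free p u v)
  ... | true  | true  | false = refl
  ... | true  | false | true  = refl
  ... | true  | false | false = refl
  ... | false | true  | true  = refl
  ... | false | true  | false = refl
  ... | false | false | true  = refl
  ... | false | false | false = refl

  -- The pointwise identity leaves only the edges meeting the non-neighbours of
  -- p, whose degrees are at most that of p.
  few-misplaced : ∀ p → All (λ u → degree u ≤ degree p) xs →
    2 * (∑² (λ u v → ⟦ misplaced p u v ⟧) + 3 * ∑ xs degree) ≤ 3 * (N * N)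
  few-misplaced p maximal = begin
    2 * (∑² (λ u v → ⟦ misplaced p u v ⟧) + 3 * ∑ xs degree)
      ≡⟨ cong (2 *_) total ⟩
    2 * (d * c + c * d + (2 * D + 2 * D))
      ≤⟨ *-monoʳ-≤ 2 (+-monoʳ-≤ (d * c + c * d) (+-mono-≤ (*-monoʳ-≤ 2 D≤) (*-monoʳ-≤ 2 D≤))) ⟩
    2 * (d * c + c * d + (2 * (c * d) + 2 * (c * d)))
      ≡⟨ collect d c ⟩
    3 * (4 * (d * c))
      ≤⟨ *-monoʳ-≤ 3 (4mn≤[m+n]² d c) ⟩
    3 * ((d + c) * (d + c))
      ≡⟨ cong (λ m → 3 * (m * m)) (tally-not xs (adj p)) ⟩
    3 * (N * N) ∎
    where
    open ≤-Reasoning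
    χ χ̄ : A → ℕ
    χ u = ⟦ adj p u ⟧
    χ̄ u = ⟦ not (adj p u) ⟧

    d c D : ℕ
    d = degree p
    c = ∑ xs χ̄
    D = ∑[ u ∈ xs ] χ̄ u * degree u

    collect : ∀ d c → 2 * (d * c + c * d + (2 * (c * d) + 2 * (c * d))) ≡ 3 * (4 * (d * c))
    collect = solve-∀

    D≤ : D ≤ c * d
    D≤ = ≤-trans (∑-mono-All (All.map (λ {u} → *-monoʳ-≤ (χ̄ u)) maximal))
      (≤-reflexive (∑-distribʳ-* xs d χ̄))

    D≡ : ∑² (λ u v → χ̄ u * ⟦ adj u v ⟧) ≡ D
    D≡ = ∑-cong xs λ u → sym (∑-distribˡ-* xs (χ̄ u) _)

    total : ∑² (λ u v → ⟦ misplaced p u v ⟧) + 3 * ∑ xs degree ≡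
      d * c + c * d + (2 * D + 2 * D)
    total = begin-equality
      ∑² (λ u v → ⟦ misplaced p u v ⟧) + 3 * ∑ xs degree
        ≡⟨ cong (∑² (λ u v → ⟦ misplaced p u v ⟧) +_) (∑²-* 3 (λ u v → ⟦ adj u v ⟧)) ⟩
      ∑² (λ u v → ⟦ misplaced p u v ⟧) + ∑² (λ u v → 3 * ⟦ adj u v ⟧)
        ≡⟨ ∑²-+ _ _ ⟨
      ∑² (λ u v → ⟦ misplaced p u v ⟧ + 3 * ⟦ adj u v ⟧)
        ≡⟨ ∑-cong xs (λ u → ∑-cong xs (pointwise p u)) ⟩
      ∑² (λ u v → (χ u * χ̄ v + χ̄ u * χ v) +
                  (2 * (χ̄ u * ⟦ adj u v ⟧) + 2 * (χ̄ v * ⟦ adj v u ⟧)))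
        ≡⟨ ∑²-+ _ _ ⟩
      ∑² (λ u v → χ u * χ̄ v + χ̄ u * χ v) +
      ∑² (λ u v → 2 * (χ̄ u * ⟦ adj u v ⟧) + 2 * (χ̄ v * ⟦ adj v u ⟧))
        ≡⟨ cong₂ _+_ (∑²-+ _ _) (∑²-+ _ _) ⟩
      ∑² (λ u v → χ u * χ̄ v) + ∑² (λ u v → χ̄ u * χ v) +
      (∑² (λ u v → 2 * (χ̄ u * ⟦ adj u v ⟧)) + ∑² (λ u v → 2 * (χ̄ v * ⟦ adj v u ⟧)))
        ≡⟨ cong₂ _+_ (cong₂ _+_ (∑-product xs xs χ χ̄) (∑-product xs xs χ̄ χ))
             (cong₂ _+_ (sym (∑²-* 2 _)) (trans (∑-comm xs xs _) (sym (∑²-* 2 _)))) ⟩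
      d * c + c * d + (2 * ∑² (λ u v → χ̄ u * ⟦ adj u v ⟧) + 2 * ∑² (λ u v → χ̄ u * ⟦ adj u v ⟧))
        ≡⟨ cong (λ m → d * c + c * d + (2 * m + 2 * m)) D≡ ⟩
      d * c + c * d + (2 * D + 2 * D) ∎

-- Counting k-sets through ordered k-tuples.

count≡tally : ∀ {P : Pred (Subset n) 0ℓ} (P? : Decidable P) →
  count P? ≡ tally (subsets n) (does ∘ P?)
count≡tally {n} {P} P? = go (subsets n)
  where
  go : ∀ Ss → length (filter P? Ss) ≡ tally Ss (does ∘ P?)
  go []       = refl
  go (S ∷ Ss) with does (P? S)
  ... | true  = cong suc (go Ss)
  ... | false = go Ss

insert : Fin n → Subset n → Subset n
insert i S = ⁅ i ⁆ ∪ S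

insert-old : ∀ (i : Fin n) S → lookup S i ≡ true → insert i S ≡ S
insert-old zero    (inside ∷ S) eq = cong (inside ∷_) (∪-identityˡ S)
insert-old (suc i) (s ∷ S)      eq = cong (s ∷_) (insert-old i S eq)

∣insert-new∩∣ : ∀ (i : Fin n) S V → lookup S i ≡ false →
  ∣ insert i S ∩ V ∣ ≡ ⟦ lookup V i ⟧ + ∣ S ∩ V ∣
∣insert-new∩∣ zero    (outside ∷ S) (inside  ∷ V) eq =
  cong (λ T → suc ∣ T ∩ V ∣) (∪-identityˡ S)
∣insert-new∩∣ zero    (outside ∷ S) (outside ∷ V) eq = cong (λ T → ∣ T ∩ V ∣) (∪-identityˡ S)
∣insert-new∩∣ (suc i) (inside  ∷ S) (inside  ∷ V) eq =
  trans (cong suc (∣insert-new∩∣ i S V eq)) (sym (+-suc _ _))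
∣insert-new∩∣ (suc i) (inside  ∷ S) (outside ∷ V) eq = ∣insert-new∩∣ i S V eq
∣insert-new∩∣ (suc i) (outside ∷ S) (v ∷ V)       eq = ∣insert-new∩∣ i S V eq

∣insert-new∣ : ∀ (i : Fin n) S → lookup S i ≡ false → ∣ insert i S ∣ ≡ suc ∣ S ∣
∣insert-new∣ zero    (outside ∷ S) eq = cong (suc ∘ ∣_∣) (∪-identityˡ S)
∣insert-new∣ (suc i) (inside  ∷ S) eq = cong suc (∣insert-new∣ i S eq)
∣insert-new∣ (suc i) (outside ∷ S) eq = ∣insert-new∣ i S eq

lookup-insert : ∀ (i : Fin n) S → lookup (insert i S) i ≡ true
lookup-insert zero    (s ∷ S) = refl
lookup-insert (suc i) (s ∷ S) = lookup-insert i S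

∣insert∣≤ : ∀ (i : Fin n) S → ∣ insert i S ∣ ≤ suc ∣ S ∣
∣insert∣≤ i S with lookup S i in eq
... | true  = subst (λ T → ∣ T ∣ ≤ suc ∣ S ∣) (sym (insert-old i S eq)) (n≤1+n _)
... | false = ≤-reflexive (∣insert-new∣ i S eq)

tally-lookup : ∀ (S : Subset n) → tally (allFin n) (lookup S) ≡ ∣ S ∣
tally-lookup [] = refl
tally-lookup {suc n} (s ∷ S) with s
... | true  = trans (∑-allFin n (⟦_⟧ ∘ lookup (true ∷ S))) (cong suc (tally-lookup S))
... | false = trans (∑-allFin n (⟦_⟧ ∘ lookup (false ∷ S))) (tally-lookup S)

-- extend′ also counts the degenerate extensions, where the new point already
-- belongs to T.
extend extend′ : (Subset n → ℕ) → Subset n → ℕ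
extend  {n} g T = ∑[ i ∈ allFin n ] ⟦ not (lookup T i) ⟧ * g (insert i T)
extend′ {n} g T = ∑[ i ∈ allFin n ] g (insert i T)

-- Double counting of the pairs of a set S and an element i of S: removing i leaves a set T that
-- `extend` enlarges by i again.
∑-extend : ∀ n (g : Subset n → ℕ) → ∑ (subsets n) (extend g) ≡ ∑[ S ∈ subsets n ] ∣ S ∣ * g S
∑-extend zero    g = refl
∑-extend (suc n) g = begin
  ∑ (map (inside ∷_) Ss ++ map (outside ∷_) Ss) (extend g)
    ≡⟨ split (extend g) ⟩
  ∑ Ss (extend g ∘ (inside ∷_)) + ∑ Ss (extend g ∘ (outside ∷_))
    ≡⟨ cong₂ _+_ (∑-cong Ss λ S → ∑-allFin n (summand (inside ∷ S)))
                 (∑-cong Ss λ S → ∑-allFin n (summand (outside ∷ S))) ⟩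
  -- A set containing `zero` cannot be extended by it; a set avoiding it can, and this extension is
  -- the separate term with `g₁`.
  ∑ Ss (extend g₁) + ∑ Ss (λ S → 1 * g₁ (⊥ ∪ S) + extend g₀ S)
    ≡⟨ cong (∑ Ss (extend g₁) +_) (trans
         (∑-cong Ss λ S → cong₂ _+_ (trans (*-identityˡ _) (cong g₁ (∪-identityˡ S))) refl)
         (∑-distrib-+ Ss g₁ (extend g₀))) ⟩
  ∑ Ss (extend g₁) + (∑ Ss g₁ + ∑ Ss (extend g₀))
    ≡⟨ cong₂ (λ a b → a + (∑ Ss g₁ + b)) (∑-extend n g₁) (∑-extend n g₀) ⟩
  ∑ Ss (λ S → ∣ S ∣ * g₁ S) + (∑ Ss g₁ + ∑ Ss (λ S → ∣ S ∣ * g₀ S))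
    ≡⟨ rearrange (∑ Ss (λ S → ∣ S ∣ * g₁ S)) (∑ Ss g₁) (∑ Ss (λ S → ∣ S ∣ * g₀ S)) ⟩
  ∑ Ss g₁ + ∑ Ss (λ S → ∣ S ∣ * g₁ S) + ∑ Ss (λ S → ∣ S ∣ * g₀ S)
    ≡⟨ cong (_+ ∑ Ss (λ S → ∣ S ∣ * g₀ S)) (∑-distrib-+ Ss g₁ _) ⟨
  ∑ Ss (λ S → g₁ S + ∣ S ∣ * g₁ S) + ∑ Ss (λ S → ∣ S ∣ * g₀ S)
    ≡⟨ split (λ S → ∣ S ∣ * g S) ⟨
  ∑ (map (inside ∷_) Ss ++ map (outside ∷_) Ss) (λ S → ∣ S ∣ * g S) ∎
  where
  open ≡-Reasoning
  Ss = subsets n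
  g₁ g₀ : Subset n → ℕ
  g₁ S = g (inside ∷ S)
  g₀ S = g (outside ∷ S)
  summand : Subset (suc n) → Fin (suc n) → ℕ
  summand T i = ⟦ not (lookup T i) ⟧ * g (insert i T)
  rearrange : ∀ a b c → a + (b + c) ≡ b + a + c
  rearrange = solve-∀
  split : ∀ f → ∑ (map (inside ∷_) Ss ++ map (outside ∷_) Ss) f ≡
    ∑ Ss (f ∘ (inside ∷_)) + ∑ Ss (f ∘ (outside ∷_))
  split f = trans (∑-++ (map (inside ∷_) Ss) _ f)
    (cong₂ _+_ (∑-map (inside ∷_) Ss f) (∑-map (outside ∷_) Ss f))

SupportedOn : ℕ → (Subset n → ℕ) → Set
SupportedOn k g = ∀ S → ∣ S ∣ ≢ k → g S ≡ 0

extend-supported : ∀ {k} {g : Subset n → ℕ} → SupportedOn (suc k) g → SupportedOn k (extend g)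
extend-supported {n} {k} {g} supp S ∣S∣≢k =
  trans (∑-cong (allFin n) term) (trans (∑-const (allFin n) 0) (*-zeroʳ (length (allFin n))))
  where
  term : ∀ i → ⟦ not (lookup S i) ⟧ * g (insert i S) ≡ 0
  term i with lookup S i in eq
  ... | true  = refl
  ... | false = trans (*-identityˡ _)
    (supp _ λ ∣iS∣≡k → ∣S∣≢k (suc-injective (trans (sym (∣insert-new∣ i S eq)) ∣iS∣≡k)))

∑-extend-supported : ∀ {k} {g : Subset n → ℕ} → SupportedOn k g →
  ∑ (subsets n) (extend g) ≡ k * ∑ (subsets n) g
∑-extend-supported {n} {k} {g} supp =
  trans (∑-extend n g) (trans (∑-cong (subsets n) term) (sym (∑-distribˡ-* (subsets n) k g)))
  where
  term : ∀ S → ∣ S ∣ * g S ≡ k * g S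
  term S with ∣ S ∣ ≟ k
  ... | yes refl = refl
  ... | no ≢k rewrite supp S ≢k = trans (*-zeroʳ ∣ S ∣) (sym (*-zeroʳ k))

∑-supported-0 : ∀ {n} {g : Subset n → ℕ} → SupportedOn 0 g → ∑ (subsets n) g ≡ g ⊥
∑-supported-0 {zero}  supp = +-identityʳ _
∑-supported-0 {suc n} {g} supp = trans (∑-++ (map (inside ∷_) (subsets n)) _ g)
  (cong₂ _+_
    (trans (∑-map (inside ∷_) (subsets n) g)
      (trans (∑-cong (subsets n) λ S → supp (inside ∷ S) λ ())
        (trans (∑-const (subsets n) 0) (*-zeroʳ (length (subsets n))))))
    (trans (∑-map (outside ∷_) (subsets n) g) (∑-supported-0 λ S → supp (outside ∷ S))))

extends extends′ : ℕ → (Subset n → ℕ) → Subset n → ℕ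
extends  zero    g = g
extends  (suc k) g = extends k (extend g)
extends′ zero    g = g
extends′ (suc k) g = extends′ k (extend′ g)

-- A k-set is reached from `⊥` by adding its elements in any of k! orders. Each round of `extend`
-- lowers the size of the support by one and contributes one factor of k!.
!*∑ : ∀ k {g : Subset n → ℕ} → SupportedOn k g → k ! * ∑ (subsets n) g ≡ extends k g ⊥
!*∑ zero        supp = trans (*-identityˡ _) (∑-supported-0 supp)
!*∑ {n} (suc k) {g} supp = begin
  suc k * k ! * ∑ (subsets n) g    ≡⟨ cong (_* ∑ (subsets n) g) (*-comm (suc k) (k !)) ⟩
  k ! * suc k * ∑ (subsets n) g    ≡⟨ *-assoc (k !) (suc k) _ ⟩
  k ! * (suc k * ∑ (subsets n) g)  ≡⟨ cong (k ! *_) (∑-extend-supported supp) ⟨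
  k ! * ∑ (subsets n) (extend g)   ≡⟨ !*∑ k (extend-supported supp) ⟩
  extends k (extend g) ⊥           ∎
  where open ≡-Reasoning

-- Two functions are needed for the induction because `extend g` and `extend′ g` agree only on small
-- sets. On a set T of size at most k, a degenerate extension in `extend′ h` is T itself, where h
-- vanishes.
extends≡extends′ : ∀ k {g h : Subset n → ℕ} →
  (∀ T → ∣ T ∣ ≤ k → g T ≡ h T) → (∀ T → ∣ T ∣ < k → h T ≡ 0) →
  extends k g ⊥ ≡ extends′ k h ⊥
extends≡extends′ {n} zero    g≡h h≡0 = g≡h ⊥ (≤-reflexive (∣⊥∣≡0 n))
extends≡extends′ {n} (suc k) {g} {h} g≡h h≡0 = extends≡extends′ k
  (λ T ≤k → ∑-cong (allFin n) λ i → term T i ≤k)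
  (λ T <k → trans (∑-cong (allFin n) λ i → h≡0 _ (≤-<-trans (∣insert∣≤ i T) (s≤s <k)))
    (trans (∑-const (allFin n) 0) (*-zeroʳ (length (allFin n)))))
  where
  term : ∀ T i → ∣ T ∣ ≤ k → ⟦ not (lookup T i) ⟧ * g (insert i T) ≡ h (insert i T)
  term T i ≤k with lookup T i in eq
  ... | true  = sym (trans (cong h (insert-old i T eq)) (h≡0 T (s≤s ≤k)))
  ... | false = trans (*-identityˡ _) (g≡h _ (≤-trans (∣insert∣≤ i T) (s≤s ≤k)))

-- On the right-hand side, g vanishes on the tuples with a repetition.
tuple-count : ∀ k {g : Subset n → ℕ} → SupportedOn k g → k ! * ∑ (subsets n) g ≡ extends′ k g ⊥
tuple-count k supp = trans (!*∑ k supp)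
  (extends≡extends′ k (λ _ _ → refl) λ T <k → supp T (<⇒≢ <k))

-- Ordered quadruples and the sets they span.

∑⁴ : (Fin n → Fin n → Fin n → Fin n → ℕ) → ℕ
∑⁴ {n} f = ∑[ a ∈ allFin n ] ∑[ b ∈ allFin n ] ∑[ c ∈ allFin n ] ∑[ d ∈ allFin n ] f a b c d

quad : Fin n → Fin n → Fin n → Fin n → Subset n
quad a b c d = insert a (insert b (insert c (insert d ⊥)))

-- The order is reversed because the variable of the outermost sum is the first to be inserted into
-- `⊥`.
quadruple-count : ∀ {g : Subset n → ℕ} → SupportedOn 4 g →
  24 * ∑ (subsets n) g ≡ ∑⁴ (λ a b c d → g (quad d c b a))
quadruple-count = tuple-count 4

insert-comm : ∀ (i j : Fin n) S → insert i (insert j S) ≡ insert j (insert i S)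
insert-comm i j S = trans (sym (∪-assoc ⁅ i ⁆ ⁅ j ⁆ S))
  (trans (cong (_∪ S) (∪-comm ⁅ i ⁆ ⁅ j ⁆)) (∪-assoc ⁅ j ⁆ ⁅ i ⁆ S))

-- An old point would leave the size at most k. Applied from the outermost insertion inwards, this
-- shows that a quadruple spanning a 4-set has no repetition.
insert-full : ∀ {k} (i : Fin n) S → ∣ S ∣ ≤ k → ∣ insert i S ∣ ≡ suc k →
  lookup S i ≡ false × ∣ S ∣ ≡ k
insert-full i S ≤k full with lookup S i in eq
... | true  = contradiction (trans (cong ∣_∣ (sym (insert-old i S eq))) full) (<⇒≢ (s≤s ≤k))
... | false = refl , suc-injective (trans (sym (∣insert-new∣ i S eq)) full)

-- Images of sets under a map.

lookup-∪ : ∀ (S T : Subset n) i → lookup (S ∪ T) i ≡ lookup S i ∨ lookup T i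
lookup-∪ S T i = lookup-zipWith _∨_ i S T

lookup-image : ∀ {m} (f : Fin m → Fin n) S i → lookup S i ≡ true → lookup (image f S) (f i) ≡ true
lookup-image f (inside ∷ S)  zero    _  = lookup-insert (f zero) (image (f ∘ suc) S)
lookup-image f (inside ∷ S)  (suc i) eq =
  trans (lookup-∪ ⁅ f zero ⁆ (image (f ∘ suc) S) (f (suc i)))
    (trans (cong (lookup ⁅ f zero ⁆ (f (suc i)) ∨_) (lookup-image (f ∘ suc) S i eq))
      (Bool.∨-zeroʳ _))
lookup-image f (outside ∷ S) (suc i) eq = lookup-image (f ∘ suc) S i eq

∣image∣≤ : ∀ {m} (f : Fin m → Fin n) S → ∣ image f S ∣ ≤ ∣ S ∣
∣image∣≤ {n} f []   = ≤-reflexive (∣⊥∣≡0 n)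
∣image∣≤ f (inside ∷ S)  =
  ≤-trans (∣insert∣≤ (f zero) (image (f ∘ suc) S)) (s≤s (∣image∣≤ (f ∘ suc) S))
∣image∣≤ f (outside ∷ S) = ∣image∣≤ (f ∘ suc) S

-- A collision inside S would make the image smaller than S. For a map into a uniform hypergraph
-- that sends edges to edges, the size of the image is known, so injectivity on each edge follows.
image-injective : ∀ {m} (f : Fin m → Fin n) S → ∣ image f S ∣ ≡ ∣ S ∣ →
  ∀ i j → lookup S i ≡ true → lookup S j ≡ true → f i ≡ f j → i ≡ j
image-injective f (outside ∷ S) full (suc i) (suc j) i∈S j∈S eq =
  cong suc (image-injective (f ∘ suc) S full i j i∈S j∈S eq)
image-injective f (inside ∷ S) full i j i∈S j∈S eq
  with f0∉ , full′ ← insert-full (f zero) (image (f ∘ suc) S) (∣image∣≤ (f ∘ suc) S) full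
  with i | j
... | zero  | zero  = refl
... | suc i | suc j = cong suc (image-injective (f ∘ suc) S full′ i j i∈S j∈S eq)
... | zero  | suc j = contradiction
  (trans (sym (lookup-image (f ∘ suc) S j j∈S))
    (trans (cong (lookup (image (f ∘ suc) S)) (sym eq)) f0∉)) λ ()
... | suc i | zero  = contradiction
  (trans (sym (lookup-image (f ∘ suc) S i i∈S))
    (trans (cong (lookup (image (f ∘ suc) S)) eq) f0∉)) λ ()

-- Parity of a quadruple and good sets.

parity : Subset n → Fin n → Fin n → Fin n → Fin n → Bool
parity V a b c d = lookup V a xor (lookup V b xor (lookup V c xor lookup V d))

module _ (a b c d : Fin n) where

  ∣d∣≤1 : ∣ insert d ⊥ ∣ ≤ 1
  ∣d∣≤1 = ≤-trans (∣insert∣≤ d ⊥) (s≤s (≤-reflexive (∣⊥∣≡0 n)))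

  ∣cd∣≤2 : ∣ insert c (insert d ⊥) ∣ ≤ 2
  ∣cd∣≤2 = ≤-trans (∣insert∣≤ c (insert d ⊥)) (s≤s ∣d∣≤1)

  ∣bcd∣≤3 : ∣ insert b (insert c (insert d ⊥)) ∣ ≤ 3
  ∣bcd∣≤3 = ≤-trans (∣insert∣≤ b (insert c (insert d ⊥))) (s≤s ∣cd∣≤2)

  ∣quad∩∣ : ∣ quad a b c d ∣ ≡ 4 → ∀ V → ∣ quad a b c d ∩ V ∣ ≡
    ⟦ lookup V a ⟧ + (⟦ lookup V b ⟧ + (⟦ lookup V c ⟧ + (⟦ lookup V d ⟧ + 0)))
  ∣quad∩∣ full V
    with a∉ , full₃ ← insert-full a (insert b (insert c (insert d ⊥))) ∣bcd∣≤3 full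
    with b∉ , full₂ ← insert-full b (insert c (insert d ⊥)) ∣cd∣≤2 full₃
    with c∉ , full₁ ← insert-full c (insert d ⊥) ∣d∣≤1 full₂
    with d∉ , _     ← insert-full d ⊥ (≤-reflexive (∣⊥∣≡0 n)) full₁ =
    trans (∣insert-new∩∣ a _ V a∉) (cong (⟦ lookup V a ⟧ +_)
      (trans (∣insert-new∩∣ b _ V b∉) (cong (⟦ lookup V b ⟧ +_)
        (trans (∣insert-new∩∣ c _ V c∉) (cong (⟦ lookup V c ⟧ +_)
          (trans (∣insert-new∩∣ d ⊥ V d∉) (cong (⟦ lookup V d ⟧ +_)
            (trans (cong ∣_∣ (∩-zeroˡ V)) (∣⊥∣≡0 n)))))))))

  -- The right-hand side counts the insertions that repeat a point. There are three terms because d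
  -- enters the empty set and cannot be a repetition.
  degenerate : ∣ quad a b c d ∣ ≢ 4 →
    1 ≤ ⟦ lookup (insert b (insert c (insert d ⊥))) a ⟧ +
        (⟦ lookup (insert c (insert d ⊥)) b ⟧ + ⟦ lookup (insert d ⊥) c ⟧)
  degenerate ≢4
    with lookup (insert b (insert c (insert d ⊥))) a in a∉
  ... | true  = s≤s z≤n
  ... | false with lookup (insert c (insert d ⊥)) b in b∉
  ...   | true  = s≤s z≤n
  ...   | false with lookup (insert d ⊥) c in c∉
  ...     | true  = s≤s z≤n
  ...     | false = contradiction
    (trans (∣insert-new∣ a _ a∉) (cong suc (trans (∣insert-new∣ b _ b∉)
      (cong suc (trans (∣insert-new∣ c _ c∉) (cong suc ∣d∣≡1)))))) ≢4
    where
    ∣d∣≡1 : ∣ insert d ⊥ ∣ ≡ 1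
    ∣d∣≡1 = trans (∣insert-new∣ d ⊥ (lookup-⊥ d)) (cong suc (∣⊥∣≡0 n))
      where
      lookup-⊥ : ∀ {m} (i : Fin m) → lookup ⊥ i ≡ false
      lookup-⊥ zero    = refl
      lookup-⊥ (suc i) = lookup-⊥ i

  -- The odd numbers up to 4 are 1 and 3, and with four distinct points either of them in V leaves
  -- the other in the complement.
  good?-quad : ∀ V → ∣ quad a b c d ∣ ≡ 4 → does (good? V (quad a b c d)) ≡ parity V a b c d
  good?-quad V full
    rewrite ∣quad∩∣ full V | ∣quad∩∣ full (∁ V) | full
    | lookup-map a not V | lookup-map b not V | lookup-map c not V | lookup-map d not V
    with lookup V a | lookup V b | lookup V c | lookup V d
  ... | true  | true  | true  | true  = refl
  ... | true  | true  | true  | false = refl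
  ... | true  | true  | false | true  = refl
  ... | true  | true  | false | false = refl
  ... | true  | false | true  | true  = refl
  ... | true  | false | true  | false = refl
  ... | true  | false | false | true  = refl
  ... | true  | false | false | false = refl
  ... | false | true  | true  | true  = refl
  ... | false | true  | true  | false = refl
  ... | false | true  | false | true  = refl
  ... | false | true  | false | false = refl
  ... | false | false | true  | true  = refl
  ... | false | false | true  | false = refl
  ... | false | false | false | true  = refl
  ... | false | false | false | false = refl

-- Counting edges and incorrect sets by quadruples.

∑⁴-cong : {f g : Fin n → Fin n → Fin n → Fin n → ℕ} →
  (∀ a b c d → f a b c d ≡ g a b c d) → ∑⁴ f ≡ ∑⁴ g
∑⁴-cong {n} eq = ∑-cong Fs λ a → ∑-cong Fs λ b → ∑-cong Fs λ c → ∑-cong Fs (eq a b c)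
  where Fs = allFin n

∑⁴-mono : {f g : Fin n → Fin n → Fin n → Fin n → ℕ} →
  (∀ a b c d → f a b c d ≤ g a b c d) → ∑⁴ f ≤ ∑⁴ g
∑⁴-mono {n} le = ∑-mono Fs λ a → ∑-mono Fs λ b → ∑-mono Fs λ c → ∑-mono Fs (le a b c)
  where Fs = allFin n

∑⁴-distrib-+ : ∀ (f g : Fin n → Fin n → Fin n → Fin n → ℕ) →
  ∑⁴ (λ a b c d → f a b c d + g a b c d) ≡ ∑⁴ f + ∑⁴ g
∑⁴-distrib-+ {n} f g =
  trans (∑-cong Fs λ a → trans (∑-cong Fs λ b → trans (∑-cong Fs λ c →
    ∑-distrib-+ Fs (f a b c) (g a b c)) (∑-distrib-+ Fs _ _)) (∑-distrib-+ Fs _ _))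
    (∑-distrib-+ Fs _ _)
  where Fs = allFin n

quad-reverse : ∀ (a b c d : Fin n) → quad d c b a ≡ quad a b c d
quad-reverse a b c d = begin
  quad d c b a  ≡⟨ cong (insert d ∘ insert c) (insert-comm b a ⊥) ⟩
  quad d c a b  ≡⟨ cong (insert d) (insert-comm c a _) ⟩
  quad d a c b  ≡⟨ insert-comm d a _ ⟩
  quad a d c b  ≡⟨ cong (insert a ∘ insert d) (insert-comm c b ⊥) ⟩
  quad a d b c  ≡⟨ cong (insert a) (insert-comm d b _) ⟩
  quad a b d c  ≡⟨ cong (insert a ∘ insert b) (insert-comm d c ⊥) ⟩
  quad a b c d  ∎
  where open ≡-Reasoning

count-quad : ∀ {P : Pred (Subset n) 0ℓ} (P? : Decidable P) → (∀ {S} → P S → ∣ S ∣ ≡ 4) →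
  24 * count P? ≡ ∑⁴ (λ a b c d → ⟦ does (P? (quad a b c d)) ⟧)
count-quad {n} {P} P? uniform = trans (cong (24 *_) (count≡tally P?))
  (trans (quadruple-count {g = ⟦_⟧ ∘ does ∘ P?} supported)
    (∑⁴-cong λ a b c d → cong (⟦_⟧ ∘ does ∘ P?) (quad-reverse a b c d)))
  where
  supported : SupportedOn 4 (⟦_⟧ ∘ does ∘ P?)
  supported S ≢4 with P? S
  ... | yes p = contradiction (uniform p) ≢4
  ... | no  _ = refl

⟦⟧≤1 : ∀ x → ⟦ x ⟧ ≤ 1
⟦⟧≤1 true  = s≤s z≤n
⟦⟧≤1 false = z≤n

⟦does⟧≤ : ∀ {P : Set} (P? : Dec P) {x} → (P → x ≡ true) → ⟦ does P? ⟧ ≤ ⟦ x ⟧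
⟦does⟧≤ (no _)  _   = z≤n
⟦does⟧≤ (yes p) p⇒x = ≤-reflexive (cong ⟦_⟧ (sym (p⇒x p)))

xor-does : ∀ {P Q : Set} (P? : Dec P) (Q? : Dec Q) → ¬ ((Q × P) ⊎ (¬ Q × ¬ P)) →
  does P? xor does Q? ≡ true
xor-does (yes p) (yes q) ¬same = contradiction (inj₁ (q , p)) ¬same
xor-does (yes p) (no ¬q) ¬same = refl
xor-does (no ¬p) (yes q) ¬same = refl
xor-does (no ¬p) (no ¬q) ¬same = contradiction (inj₂ (¬q , ¬p)) ¬same

-- On a quadruple without repetition, parity decides goodness, so the set is incorrect exactly if
-- edge and parity disagree. Quadruples with a repetition can only add to the right-hand side.
incorrect-count : ∀ (H : Hypergraph 4 n) V → 24 * incorrect4Sets H V ≤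
  ∑⁴ (λ a b c d → ⟦ does (edge? H (quad a b c d)) xor parity V a b c d ⟧)
incorrect-count H V = ≤-trans (≤-reflexive (count-quad incorrect? proj₁)) (∑⁴-mono pointwise)
  where
  incorrect? : Decidable (λ S → ∣ S ∣ ≡ 4 × ¬ Correct H V S)
  incorrect? S = (∣ S ∣ ≟ 4) ×-dec ¬? (correct? H V S)

  pointwise : ∀ a b c d → ⟦ does (incorrect? (quad a b c d)) ⟧ ≤
    ⟦ does (edge? H (quad a b c d)) xor parity V a b c d ⟧
  pointwise a b c d = ⟦does⟧≤ (incorrect? (quad a b c d)) λ (full , ¬correct) →
    trans (cong (does (edge? H (quad a b c d)) xor_) (sym (good?-quad a b c d V full)))
      (xor-does (edge? H (quad a b c d)) (good? V (quad a b c d)) ¬correct)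

-- A lower bound for b(n).

length-allFin : ∀ n → length (allFin n) ≡ n
length-allFin n = length-tabulate {n = n} (λ i → i)

∑-≤ : ∀ n k {f : Fin n → ℕ} → (∀ i → f i ≤ k) → ∑ (allFin n) f ≤ n * k
∑-≤ n k le = ≤-trans (∑-mono (allFin n) le)
  (≤-reflexive (trans (∑-const (allFin n) k) (cong (_* k) (length-allFin n))))

-- Parity and goodness agree on quadruples without repetition, so the error is at most the number of
-- quadruples with one.
parity≤good : ∀ (V : Subset n) → ∑⁴ (λ a b c d → ⟦ parity V d c b a ⟧) ≤
  24 * count (good? V) + 6 * (n * (n * n))
parity≤good {n} V = begin
  ∑⁴ (λ a b c d → ⟦ parity V d c b a ⟧)
    ≤⟨ ∑⁴-mono pointwise ⟩
  ∑⁴ (λ a b c d → good a b c d + (repeat₁ a b c d + (repeat₂ a b c d + repeat₃ a b c d)))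
    ≡⟨ trans (∑⁴-distrib-+ good _) (cong (∑⁴ good +_)
         (trans (∑⁴-distrib-+ repeat₁ _) (cong (∑⁴ repeat₁ +_) (∑⁴-distrib-+ repeat₂ repeat₃)))) ⟩
  -- The fourth, third and second vertex can each coincide with at most 3, 2 and 1 earlier ones; 3 +
  -- 2 + 1 = 6.
  ∑⁴ good + (∑⁴ repeat₁ + (∑⁴ repeat₂ + ∑⁴ repeat₃))
    ≤⟨ +-monoʳ-≤ (∑⁴ good) (+-mono-≤ repeat₁≤ (+-mono-≤ repeat₂≤ repeat₃≤)) ⟩
  ∑⁴ good + (n * (n * (n * 3)) + (n * (n * (n * 2)) + n * (n * (n * 1))))
    ≡⟨ cong₂ _+_
         (trans (∑⁴-cong λ a b c d → cong (⟦_⟧ ∘ does ∘ good? V) (quad-reverse a b c d))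
           (sym (count-quad (good? V) proj₁)))
         (collect n) ⟩
  24 * count (good? V) + 6 * (n * (n * n)) ∎
  where
  open ≤-Reasoning
  good repeat₁ repeat₂ repeat₃ : Fin n → Fin n → Fin n → Fin n → ℕ
  good    a b c d = ⟦ does (good? V (quad d c b a)) ⟧
  repeat₁ a b c d = ⟦ lookup (insert c (insert b (insert a ⊥))) d ⟧
  repeat₂ a b c d = ⟦ lookup (insert b (insert a ⊥)) c ⟧
  repeat₃ a b c d = ⟦ lookup (insert a ⊥) b ⟧

  collect : ∀ n → n * (n * (n * 3)) + (n * (n * (n * 2)) + n * (n * (n * 1))) ≡ 6 * (n * (n * n))
  collect = solve-∀

  pointwise : ∀ a b c d → ⟦ parity V d c b a ⟧ ≤
    good a b c d + (repeat₁ a b c d + (repeat₂ a b c d + repeat₃ a b c d))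
  pointwise a b c d with ∣ quad d c b a ∣ ≟ 4
  ... | yes full = ≤-trans (≤-reflexive (cong ⟦_⟧ (sym (good?-quad d c b a V full))))
    (m≤m+n (good a b c d) _)
  ... | no ≢4    = ≤-trans (⟦⟧≤1 _) (≤-trans (degenerate d c b a ≢4) (m≤n+m _ (good a b c d)))

  repeat₁≤ : ∑⁴ repeat₁ ≤ n * (n * (n * 3))
  repeat₁≤ = ∑-≤ n _ λ a → ∑-≤ n _ λ b → ∑-≤ n 3 λ c →
    ≤-trans (≤-reflexive (tally-lookup (insert c (insert b (insert a ⊥))))) (∣bcd∣≤3 a c b a)

  repeat₂≤ : ∑⁴ repeat₂ ≤ n * (n * (n * 2))
  repeat₂≤ = ∑-≤ n _ λ a → ∑-≤ n _ λ b → ≤-trans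
    (≤-reflexive (∑-comm (allFin n) (allFin n) λ c d → ⟦ lookup (insert b (insert a ⊥)) c ⟧))
    (∑-≤ n 2 λ d → ≤-trans (≤-reflexive (tally-lookup (insert b (insert a ⊥)))) (∣cd∣≤2 a a b a))

  repeat₃≤ : ∑⁴ repeat₃ ≤ n * (n * (n * 1))
  repeat₃≤ = ∑-≤ n _ λ a → ≤-trans
    (≤-reflexive (∑-comm (allFin n) (allFin n) λ b c → ∑[ d ∈ allFin n ] ⟦ lookup (insert a ⊥) b ⟧))
    (∑-≤ n _ λ c → ≤-trans
      (≤-reflexive (∑-comm (allFin n) (allFin n) λ b d → ⟦ lookup (insert a ⊥) b ⟧))
      (∑-≤ n 1 λ d → ≤-trans (≤-reflexive (tally-lookup (insert a ⊥))) (∣d∣≤1 a a a a)))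

-- If p vertices lie in V and q do not, then, G being a function of a parity,
-- step p q G z sums G (v xor z) over the indicators v of the vertices.
step : ℕ → ℕ → (Bool → ℕ) → Bool → ℕ
step p q G z = p * G (not z) + q * G z

-- The vertices are summed out one at a time, the innermost first; it is the leftmost operand of the
-- xor, and the parity of the others is the argument z of `step`.
∑⁴-parity : ∀ (V : Subset n) {p q} → tally (allFin n) (lookup V) ≡ p →
  tally (allFin n) (not ∘ lookup V) ≡ q →
  ∑⁴ (λ a b c d → ⟦ parity V d c b a ⟧) ≡ step p q (step p q (step p q (step p q ⟦_⟧))) false
∑⁴-parity {n} V {p} {q} refl refl =
  trans (∑-cong Fs λ a → trans (∑-cong Fs λ b → trans (∑-cong Fs λ c →
    ∑-step ⟦_⟧ (lookup V c xor (lookup V b xor lookup V a)))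
    (∑-step (step p q ⟦_⟧) (lookup V b xor lookup V a)))
    (∑-step (step p q (step p q ⟦_⟧)) (lookup V a)))
    (∑-∘-Bool Fs (lookup V) (step p q (step p q (step p q ⟦_⟧))))
  where
  Fs = allFin n
  ∑-step : ∀ G z → ∑ Fs (λ i → G (lookup V i xor z)) ≡ step p q G z
  ∑-step G z = ∑-∘-Bool Fs (lookup V) (λ v → G (v xor z))

-- The lets spell out step and the power so that the solver sees polynomials.
balanced : ∀ p q → q ≡ p ⊎ q ≡ suc p → (p + q) ^ 4 ≤
  2 * step p q (step p q (step p q (step p q ⟦_⟧))) false + 1
-- The number of odd quadruples is half the difference of the fourth powers of p + q and q - p. The
-- subtracted power is 0 here and 1 in the other case.
balanced p q (inj₁ refl) = ≤-trans (≤-reflexive (even p)) (m≤m+n _ 1)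
  where
  even : ∀ p → let
    m = p + p
    t₁ = p * 0 + p * 1 ; f₁ = p * 1 + p * 0
    t₂ = p * f₁ + p * t₁ ; f₂ = p * t₁ + p * f₁
    t₃ = p * f₂ + p * t₂ ; f₃ = p * t₂ + p * f₂
    in m * (m * (m * (m * 1))) ≡ 2 * (p * t₃ + p * f₃)
  even = solve-∀
balanced p q (inj₂ refl) = ≤-reflexive (odd p)
  where
  odd : ∀ p → let
    q = 1 + p ; m = p + q
    t₁ = p * 0 + q * 1 ; f₁ = p * 1 + q * 0
    t₂ = p * f₁ + q * t₁ ; f₂ = p * t₁ + q * f₁
    t₃ = p * f₂ + q * t₂ ; f₃ = p * t₂ + q * f₂
    in m * (m * (m * (m * 1))) ≡ 2 * (p * t₃ + q * f₃) + 1
  odd = solve-∀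

tally-firstVertices : ∀ n k → k ≤ n → tally (allFin n) (λ i → does (toℕ i <? k)) ≡ k
tally-firstVertices zero    zero    _         = refl
tally-firstVertices (suc n) zero    _         =
  trans (∑-allFin n (λ i → ⟦ does (toℕ i <? 0) ⟧)) (tally-firstVertices n zero z≤n)
tally-firstVertices (suc n) (suc k) (s≤s k≤n) =
  trans (∑-allFin n (λ i → ⟦ does (toℕ i <? suc k) ⟧)) (cong suc (tally-firstVertices n k k≤n))

⌈n/2⌉-cases : ∀ n → ⌈ n /2⌉ ≡ ⌊ n /2⌋ ⊎ ⌈ n /2⌉ ≡ suc ⌊ n /2⌋
⌈n/2⌉-cases zero          = inj₁ refl
⌈n/2⌉-cases (suc zero)    = inj₂ refl
⌈n/2⌉-cases (suc (suc n)) = Sum.map (cong suc) (cong suc) (⌈n/2⌉-cases n)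

e-𝓑≤b : ∀ n k → k ≤ n → e (𝓑 n k) ≤ b n
e-𝓑≤b n k k≤n = v≤max⁺ 0 (map (λ k → e (𝓑 n k)) (upTo (suc n)))
  (inj₂ (lose (∈-map⁺ (λ k → e (𝓑 n k)) (∈-upTo⁺ (s≤s k≤n))) ≤-refl))

-- The split at `⌊ n /2⌋` makes about half of all quadruples odd, and each good set arises from 24
-- of them. The cubic term pays for repetitions, the 1 for odd n.
b-lower-bound : ∀ n → n ^ 4 ≤ 48 * b n + (12 * (n * (n * n)) + 1)
b-lower-bound n = begin
  n ^ 4             ≡⟨ cong (_^ 4) (⌊n/2⌋+⌈n/2⌉≡n n) ⟨
  (p + q) ^ 4       ≤⟨ balanced p q (⌈n/2⌉-cases n) ⟩
  2 * step p q (step p q (step p q (step p q ⟦_⟧))) false + 1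
                    ≡⟨ cong (λ m → 2 * m + 1) (∑⁴-parity V tally-V tally-∁V) ⟨
  2 * ∑⁴ (λ a b c d → ⟦ parity V d c b a ⟧) + 1
                    ≤⟨ +-monoˡ-≤ 1 (*-monoʳ-≤ 2 (parity≤good V)) ⟩
  2 * (24 * e (𝓑 n p) + 6 * (n * (n * n))) + 1
                    ≤⟨ +-monoˡ-≤ 1 (*-monoʳ-≤ 2 (+-monoˡ-≤ (6 * (n * (n * n)))
                         (*-monoʳ-≤ 24 (e-𝓑≤b n p (⌊n/2⌋≤n n))))) ⟩
  2 * (24 * b n + 6 * (n * (n * n))) + 1
                    ≡⟨ collect (b n) (n * (n * n)) ⟩
  48 * b n + (12 * (n * (n * n)) + 1) ∎
  where
  open ≤-Reasoning
  p = ⌊ n /2⌋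
  q = ⌈ n /2⌉
  V = firstVertices n p
  collect : ∀ x y → 2 * (24 * x + 6 * y) + 1 ≡ 48 * x + (12 * y + 1)
  collect = solve-∀
  tally-V : tally (allFin n) (lookup V) ≡ p
  tally-V = trans (∑-cong (allFin n) λ i → cong ⟦_⟧ (lookup∘tabulate _ i))
    (tally-firstVertices n p (⌊n/2⌋≤n n))
  tally-∁V : tally (allFin n) (not ∘ lookup V) ≡ q
  tally-∁V = +-cancelˡ-≡ p _ q (trans
    (trans (cong (_+ tally (allFin n) (not ∘ lookup V)) (sym tally-V))
      (tally-not (allFin n) (lookup V)))
    (trans (length-allFin n) (sym (⌊n/2⌋+⌈n/2⌉≡n n))))

-- Triangles of pairs are copies of 𝓒₃⁽⁴⁾.

covered : Fin 6 → Fin 6 → Bool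
covered i j = together abcd ∨ (together abef ∨ together cdef)
  where
  together : Subset 6 → Bool
  together S = lookup S i ∧ lookup S j

-- This turns injectivity on each of the three edges into injectivity on all six vertices. The 36
-- cases are settled by evaluation.
all-covered : ∀ i j → covered i j ≡ true
all-covered = from-yes (all? λ i → all? λ j → covered i j Bool.≟ true)

module _ (H : Hypergraph 4 n) where

  -- Pairs with equal entries are included, so there are exactly n² pairs; by uniformity they are
  -- isolated.
  adjacent : Fin n × Fin n → Fin n × Fin n → Bool
  adjacent (a , b) (c , d) = does (edge? H (quad a b c d))

  adjacent-comm : ∀ u v → adjacent u v ≡ adjacent v u
  adjacent-comm (a , b) (c , d) = cong (does ∘ edge? H) (begin
    quad a b c d  ≡⟨ cong (insert a) (insert-comm b c _) ⟩
    quad a c b d  ≡⟨ insert-comm a c _ ⟩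
    quad c a b d  ≡⟨ cong (insert c ∘ insert a) (insert-comm b d ⊥) ⟩
    quad c a d b  ≡⟨ cong (insert c) (insert-comm a d _) ⟩
    quad c d a b  ∎)
    where open ≡-Reasoning

  adjacent⇒Edge : ∀ a b c d → adjacent (a , b) (c , d) ≡ true → Edge H (quad a b c d)
  adjacent⇒Edge a b c d eq with edge? H (quad a b c d)
  ... | yes edge = edge
  ... | no _     = contradiction eq λ ()

  -- The entries of the three pairs are the images of a, ..., f. They are distinct because each edge
  -- of H has four elements and any two of the six vertices share an edge.
  adjacent-triangle-free : ¬ Contains H 𝓒₃⁽⁴⁾ →
    ∀ u v w → ¬ (adjacent u v ≡ true × adjacent u w ≡ true × adjacent v w ≡ true)
  adjacent-triangle-free C-free (p₀ , p₁) (p₂ , p₃) (p₄ , p₅) (uv , uw , vw) =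
    C-free (f , f-injective , f-edges)
    where
    f : Fin 6 → Fin n
    f = lookup (p₀ ∷ p₁ ∷ p₂ ∷ p₃ ∷ p₄ ∷ p₅ ∷ [])

    f-edges : ∀ S → Edge 𝓒₃⁽⁴⁾ S → Edge H (image f S)
    f-edges S (inj₁ refl)        = adjacent⇒Edge p₀ p₁ p₂ p₃ uv
    f-edges S (inj₂ (inj₁ refl)) = adjacent⇒Edge p₀ p₁ p₄ p₅ uw
    f-edges S (inj₂ (inj₂ refl)) = adjacent⇒Edge p₂ p₃ p₄ p₅ vw

    injective-on : ∀ S → Edge 𝓒₃⁽⁴⁾ S → ∀ i j →
      lookup S i ∧ lookup S j ≡ true → f i ≡ f j → i ≡ j
    injective-on S edge i j ij∈S = image-injective f S
      (trans (uniform H (f-edges S edge)) (sym (uniform 𝓒₃⁽⁴⁾ edge))) i j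
      (Bool.∧-conicalˡ _ _ ij∈S) (Bool.∧-conicalʳ (lookup S i) _ ij∈S)

    f-injective : Injective _≡_ _≡_ f
    f-injective {i} {j} eq
      -- If all three memberships are false, the type of `all-covered i j` becomes `false ≡ true`,
      -- so three cases are exhaustive.
      with lookup abcd i ∧ lookup abcd j in ∈abcd
         | lookup abef i ∧ lookup abef j in ∈abef
         | lookup cdef i ∧ lookup cdef j in ∈cdef
         | all-covered i j
    ... | true  | _     | _    | _ = injective-on abcd (inj₁ refl) i j ∈abcd eq
    ... | false | true  | _    | _ = injective-on abef (inj₂ (inj₁ refl)) i j ∈abef eq
    ... | false | false | true | _ = injective-on cdef (inj₂ (inj₂ refl)) i j ∈cdef eq

-- The parity identity on six points.

⟦xor⟧≤ : ∀ x y → ⟦ x xor y ⟧ ≤ ⟦ x ⟧ + ⟦ y ⟧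
⟦xor⟧≤ true  true  = z≤n
⟦xor⟧≤ true  false = s≤s z≤n
⟦xor⟧≤ false y     = ≤-refl

-- The seven terms below correspond to the seven pairs of pairs abcd, xyab, xayb,
-- xycd, xcyd, xybd and xdyb; an edge xy·· occurring in two of them cancels.
xor-identity : ∀ E Eab Ecd Ebd χab χcd χxy χxa χxb χxc χxd χyb χyd →
  E xor (χxa xor (χxb xor (χxc xor χxd))) ≡
  (E xor (χab xor χcd)) xor
  (((Eab xor (χxy xor χab)) xor (Eab xor (χxa xor χyb))) xor
  (((Ecd xor (χxy xor χcd)) xor (Ecd xor (χxc xor χyd))) xor
  ((Ebd xor (χxb xor χyd)) xor (Ebd xor (χxd xor χyb)))))
xor-identity = solve 13 (λ E Eab Ecd Ebd χab χcd χxy χxa χxb χxc χxd χyb χyd →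
  E :+ (χxa :+ (χxb :+ (χxc :+ χxd))) :=
  (E :+ (χab :+ χcd)) :+
  (((Eab :+ (χxy :+ χab)) :+ (Eab :+ (χxa :+ χyb))) :+
  (((Ecd :+ (χxy :+ χcd)) :+ (Ecd :+ (χxc :+ χyd))) :+
  ((Ebd :+ (χxb :+ χyd)) :+ (Ebd :+ (χxd :+ χyb)))))) refl
  where open xor-∧-Solver

-- Sums over six points.

∑⁴-*ˡ : ∀ k (f : Fin n → Fin n → Fin n → Fin n → ℕ) →
  ∑⁴ (λ a b c d → k * f a b c d) ≡ k * ∑⁴ f
∑⁴-*ˡ {n} k f =
  trans (∑-cong Fs λ a → trans (∑-cong Fs λ b → trans (∑-cong Fs λ c →
      sym (∑-distribˡ-* Fs k (f a b c)))
    (sym (∑-distribˡ-* Fs k _))) (sym (∑-distribˡ-* Fs k _))) (sym (∑-distribˡ-* Fs k _))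
  where Fs = allFin n

∑-pad : ∀ n k → ∑ (allFin n) (λ _ → k) ≡ n * k
∑-pad n k = trans (∑-const (allFin n) k) (cong (_* k) (length-allFin n))

∑-*ˡ : ∀ n k (f : Fin n → ℕ) → ∑ (allFin n) (λ i → k * f i) ≡ k * ∑ (allFin n) f
∑-*ˡ n k f = sym (∑-distribˡ-* (allFin n) k f)

∑⁶ : (Fin n → Fin n → Fin n → Fin n → Fin n → Fin n → ℕ) → ℕ
∑⁶ {n} f = ∑[ x ∈ allFin n ] ∑[ y ∈ allFin n ] ∑⁴ (f x y)

∑⁶-distrib-+ : ∀ (f g : Fin n → Fin n → Fin n → Fin n → Fin n → Fin n → ℕ) →
  ∑⁶ (λ x y a b c d → f x y a b c d + g x y a b c d) ≡ ∑⁶ f + ∑⁶ g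
∑⁶-distrib-+ {n} f g = trans
  (∑-cong (allFin n) λ x → trans (∑-cong (allFin n) λ y → ∑⁴-distrib-+ (f x y) (g x y))
    (∑-distrib-+ (allFin n) _ _))
  (∑-distrib-+ (allFin n) _ _)

module _ (G : Fin n → Fin n → Fin n → Fin n → ℕ) where

  -- Each of the two points absent from G contributes a factor n. The same holds for the next three
  -- sums, which differ in the position of the absent points.
  ∑⁶-abcd : ∑⁶ (λ x y a b c d → G a b c d) ≡ n * (n * ∑⁴ G)
  ∑⁶-abcd = trans (∑-cong (allFin n) λ x → ∑-pad n (∑⁴ G)) (∑-pad n (n * ∑⁴ G))

  ∑⁶-xyab : ∑⁶ (λ x y a b c d → G x y a b) ≡ n * (n * ∑⁴ G)
  ∑⁶-xyab = trans
    (∑⁴-cong λ x y a b →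
      trans (∑-cong (allFin n) λ c → ∑-pad n (G x y a b)) (∑-pad n (n * G x y a b)))
    (trans (∑⁴-*ˡ n (λ x y a b → n * G x y a b)) (cong (n *_) (∑⁴-*ˡ n G)))

  ∑⁶-xycd : ∑⁶ (λ x y a b c d → G x y c d) ≡ n * (n * ∑⁴ G)
  ∑⁶-xycd = trans
    (∑-cong (allFin n) λ x → trans
      (∑-cong (allFin n) λ y →
        trans (∑-cong (allFin n) λ a → ∑-pad n (S x y)) (∑-pad n (n * S x y)))
      (trans (∑-*ˡ n n (λ y → n * S x y)) (cong (n *_) (∑-*ˡ n n (S x)))))
    (trans (∑-*ˡ n n _) (cong (n *_) (∑-*ˡ n n _)))
    where
    S : Fin n → Fin n → ℕ
    S x y = ∑[ c ∈ allFin n ] ∑[ d ∈ allFin n ] G x y c d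

  ∑⁶-xybd : ∑⁶ (λ x y a b c d → G x y b d) ≡ n * (n * ∑⁴ G)
  ∑⁶-xybd = trans
    (∑-cong (allFin n) λ x → trans
      (∑-cong (allFin n) λ y → trans
        (∑-cong (allFin n) λ a → trans
          (∑-cong (allFin n) λ b → ∑-pad n (∑ (allFin n) (G x y b)))
          (∑-*ˡ n n _))
        (∑-pad n (n * (∑[ b ∈ allFin n ] ∑ (allFin n) (G x y b)))))
      (trans (∑-*ˡ n n _) (cong (n *_) (∑-*ˡ n n _))))
    (trans (∑-*ˡ n n _) (cong (n *_) (∑-*ˡ n n _)))

  ∑⁴-swap₂₃ : ∑⁴ (λ x y a b → G x a y b) ≡ ∑⁴ G
  ∑⁴-swap₂₃ = ∑-cong (allFin n) λ x →
    ∑-comm (allFin n) (allFin n) λ y a → ∑[ b ∈ allFin n ] G x a y b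

  ∑⁴-swap₃₄ : ∑⁴ (λ x y a b → G x y b a) ≡ ∑⁴ G
  ∑⁴-swap₃₄ = ∑-cong (allFin n) λ x → ∑-cong (allFin n) λ y →
    ∑-comm (allFin n) (allFin n) λ a b → G x y b a

-- Averaging over the choice of x.

module Averaging {n} (E : Fin n → Fin n → Fin n → Fin n → Bool) (χ : Fin n → Fin n → Bool)
  (E-swap₂₃ : ∀ a b c d → E a b c d ≡ E a c b d)
  (E-swap₃₄ : ∀ a b c d → E a b c d ≡ E a b d c) where

  wrong : Fin n → Fin n → Fin n → Fin n → Bool
  wrong a b c d = E a b c d xor (χ a b xor χ c d)

  w : Fin n → Fin n → Fin n → Fin n → ℕ
  w a b c d = ⟦ wrong a b c d ⟧

  part : Fin n → Subset n
  part x = tabulate (χ x)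

  deviates : Fin n → Fin n → Fin n → Fin n → Fin n → Bool
  deviates x a b c d = E a b c d xor parity (part x) a b c d

  deviation : Fin n → ℕ
  deviation x = ∑⁴ λ a b c d → ⟦ deviates x a b c d ⟧

  deviates≡ : ∀ x y a b c d → deviates x a b c d ≡
    wrong a b c d xor ((wrong x y a b xor wrong x a y b) xor
    ((wrong x y c d xor wrong x c y d) xor (wrong x b y d xor wrong x d y b)))
  deviates≡ x y a b c d
    -- The first four equations unfold `part x`. The others move y to the second place, so that each
    -- of the values of E at xyab, xycd and xybd occurs twice and cancels.
    rewrite lookup∘tabulate (χ x) a | lookup∘tabulate (χ x) b
          | lookup∘tabulate (χ x) c | lookup∘tabulate (χ x) d
          | E-swap₂₃ x a y b | E-swap₂₃ x c y d | E-swap₂₃ x b y d | E-swap₂₃ x d y b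
          | E-swap₃₄ x y d b =
    xor-identity (E a b c d) (E x y a b) (E x y c d) (E x y b d)
      (χ a b) (χ c d) (χ x y) (χ x a) (χ x b) (χ x c) (χ x d) (χ y b) (χ y d)

  seven : (x y a b c d : Fin n) → ℕ
  seven x y a b c d =
    w a b c d + ((w x y a b + w x a y b) + ((w x y c d + w x c y d) + (w x b y d + w x d y b)))

  deviates≤seven : ∀ x y a b c d → ⟦ deviates x a b c d ⟧ ≤ seven x y a b c d
  deviates≤seven x y a b c d = ≤-trans (≤-reflexive (cong ⟦_⟧ (deviates≡ x y a b c d)))
    (⊕ (wrong a b c d) ≤-refl
      (⊕ (wrong x y a b xor wrong x a y b) (⟦xor⟧≤ (wrong x y a b) _)
        (⊕ (wrong x y c d xor wrong x c y d) (⟦xor⟧≤ (wrong x y c d) _)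
          (⟦xor⟧≤ (wrong x b y d) _))))
    where
    ⊕ : ∀ p {q s t} → ⟦ p ⟧ ≤ s → ⟦ q ⟧ ≤ t → ⟦ p xor q ⟧ ≤ s + t
    ⊕ p {q} p≤s q≤t = ≤-trans (⟦xor⟧≤ p q) (+-mono-≤ p≤s q≤t)

  ∑⁶-seven : ∑⁶ seven ≡ n * (n * (7 * ∑⁴ w))
  ∑⁶-seven = begin
    ∑⁶ seven
      ≡⟨ ∑⁶-⊕ w-abcd ((w-xyab ⊕ w-xayb) ⊕ ((w-xycd ⊕ w-xcyd) ⊕ (w-xbyd ⊕ w-xdyb))) (∑⁶-abcd w)
           (∑⁶-⊕ (w-xyab ⊕ w-xayb) ((w-xycd ⊕ w-xcyd) ⊕ (w-xbyd ⊕ w-xdyb))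
             (∑⁶-⊕ w-xyab w-xayb (∑⁶-xyab w) (trans (∑⁶-xyab w′) (cong nn* w′≡w)))
             (∑⁶-⊕ (w-xycd ⊕ w-xcyd) (w-xbyd ⊕ w-xdyb)
               (∑⁶-⊕ w-xycd w-xcyd (∑⁶-xycd w) (trans (∑⁶-xycd w′) (cong nn* w′≡w)))
               (∑⁶-⊕ w-xbyd w-xdyb (trans (∑⁶-xybd w′) (cong nn* w′≡w))
                 -- In `w-xdyb` the points b and d also come in the opposite order, which takes a
                 -- second exchange.
                 (trans (∑⁶-xybd (λ x y b d → w′ x y d b))
                   (cong nn* (trans (∑⁴-swap₃₄ w′) w′≡w)))))) ⟩
    nn* W + ((nn* W + nn* W) + ((nn* W + nn* W) + (nn* W + nn* W)))
      ≡⟨ collect n W ⟩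
    n * (n * (7 * W)) ∎
    where
    open ≡-Reasoning
    W = ∑⁴ w
    nn* : ℕ → ℕ
    nn* k = n * (n * k)
    Summand = Fin n → Fin n → Fin n → Fin n → Fin n → Fin n → ℕ
    w-abcd w-xyab w-xayb w-xycd w-xcyd w-xbyd w-xdyb : Summand
    w-abcd x y a b c d = w a b c d
    w-xyab x y a b c d = w x y a b
    w-xayb x y a b c d = w x a y b
    w-xycd x y a b c d = w x y c d
    w-xcyd x y a b c d = w x c y d
    w-xbyd x y a b c d = w x b y d
    w-xdyb x y a b c d = w x d y b
    _⊕_ : Summand → Summand → Summand
    (f ⊕ g) x y a b c d = f x y a b c d + g x y a b c d
    ∑⁶-⊕ : ∀ f g {k l} → ∑⁶ f ≡ k → ∑⁶ g ≡ l → ∑⁶ (f ⊕ g) ≡ k + l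
    ∑⁶-⊕ f g ∑f ∑g = trans (∑⁶-distrib-+ f g) (cong₂ _+_ ∑f ∑g)
    w′ : Fin n → Fin n → Fin n → Fin n → ℕ
    w′ x y a b = w x a y b
    w′≡w : ∑⁴ w′ ≡ ∑⁴ w
    w′≡w = ∑⁴-swap₂₃ w
    collect : ∀ n W → n * (n * W) + ((n * (n * W) + n * (n * W)) +
      ((n * (n * W) + n * (n * W)) + (n * (n * W) + n * (n * W)))) ≡ n * (n * (7 * W))
    collect = solve-∀

  -- The union bound over the seven instances, summed over all six points. The deviation does not
  -- depend on y, whence the factor n on the left; after cancelling it, the deviation of x is on
  -- average at most `7 * ∑⁴ w`.
  ∑-deviation : n * ∑ (allFin n) deviation ≤ n * (n * (7 * ∑⁴ w))
  ∑-deviation = begin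
    n * ∑ (allFin n) deviation
      ≡⟨ ∑-*ˡ n n deviation ⟨
    ∑[ x ∈ allFin n ] n * deviation x
      ≡⟨ ∑-cong (allFin n) (λ x → ∑-pad n (deviation x)) ⟨
    ∑⁶ (λ x y a b c d → ⟦ deviates x a b c d ⟧)
      ≤⟨ ∑-mono (allFin n) (λ x → ∑-mono (allFin n) λ y → ∑⁴-mono (deviates≤seven x y)) ⟩
    ∑⁶ seven
      ≡⟨ ∑⁶-seven ⟩
    n * (n * (7 * ∑⁴ w)) ∎
    where open ≤-Reasoning

∃-≤-average : ∀ m (f : Fin (suc m) → ℕ) k →
  ∑ (allFin (suc m)) f ≤ suc m * k → ∃ λ i → f i ≤ k
∃-≤-average m f k ∑≤ with x , minimal ← ∃-min f zero (Data.List.tabulate suc) =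
  x , *-cancelˡ-≤ (suc m)
    (≤-trans (≤-trans (≤-reflexive (sym (∑-pad (suc m) (f x)))) (∑-mono-All minimal)) ∑≤)

-- A partition with few incorrect sets.

module _ (m : ℕ) (H : Hypergraph 4 (suc m)) (C-free : ¬ Contains H 𝓒₃⁽⁴⁾) where

  private
    n′ = suc m
    vertices = allFin n′
    pairs = cartesianProduct vertices vertices

    ∣pairs∣ : length pairs ≡ n′ * n′
    ∣pairs∣ = begin
      length pairs              ≡⟨ *-identityʳ _ ⟨
      length pairs * 1          ≡⟨ ∑-const pairs 1 ⟨
      ∑[ _ ∈ pairs ] 1          ≡⟨ ∑-× vertices vertices (λ _ → 1) ⟩
      ∑[ _ ∈ vertices ] ∑[ _ ∈ vertices ] 1
                                ≡⟨ trans (∑-cong vertices λ _ → ∑-pad n′ 1) (∑-pad n′ (n′ * 1)) ⟩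
      n′ * (n′ * 1)             ≡⟨ cong (n′ *_) (*-identityʳ n′) ⟩
      n′ * n′                   ∎
      where open ≡-Reasoning

  open Stability pairs (adjacent H) (adjacent-comm H) (adjacent-triangle-free H C-free)

  ∑²-pairs : ∀ f → ∑² f ≡ ∑⁴ (λ a b c d → f (a , b) (c , d))
  ∑²-pairs f = trans (∑-× vertices vertices _)
    (∑-cong vertices λ a → ∑-cong vertices λ b → ∑-× vertices vertices (f (a , b)))

  private
    centre : ∃ λ p → All (λ u → degree u ≤ degree p) pairs
    -- As there is a vertex, the list of pairs unfolds to one with head `(zero , zero)`.
    centre = ∃-max degree (zero , zero) _

    E : Fin n′ → Fin n′ → Fin n′ → Fin n′ → Bool
    E a b c d = adjacent H (a , b) (c , d)

  -- With χ the neighbourhood of the centre, `wrong a b c d` is `misplaced` for the pairs ab and cd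
  -- by definition, so `few-misplaced` bounds `∑⁴ w`.
  open Averaging E (λ a b → adjacent H (proj₁ centre) (a , b))
    (λ a b c d → cong (does ∘ edge? H) (cong (insert a) (insert-comm b c (insert d ⊥))))
    (λ a b c d → cong (does ∘ edge? H) (cong (insert a ∘ insert b) (insert-comm c d ⊥)))

  -- Füredi's bound for the graph on n² pairs, whose degree sum is 24 e(H): the exceptions number at
  -- most three times the deficit n⁴/2 - 24 e(H).
  ∑⁴-w-bound : 2 * (∑⁴ w + 3 * (24 * e H)) ≤ 3 * n′ ^ 4
  ∑⁴-w-bound = begin
    2 * (∑⁴ w + 3 * (24 * e H))
      ≡⟨ cong₂ (λ x y → 2 * (x + 3 * y)) (sym (∑²-pairs λ u v → ⟦ misplaced (proj₁ centre) u v ⟧))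
           (trans (count-quad (edge? H) (uniform H)) (sym (∑²-pairs λ u v → ⟦ adjacent H u v ⟧))) ⟩
    2 * (∑² (λ u v → ⟦ misplaced (proj₁ centre) u v ⟧) + 3 * ∑ pairs degree)
      ≤⟨ few-misplaced (proj₁ centre) (proj₂ centre) ⟩
    3 * (length pairs * length pairs)
      ≡⟨ cong (λ N → 3 * (N * N)) ∣pairs∣ ⟩
    3 * ((n′ * n′) * (n′ * n′))
      ≡⟨ cong (3 *_) (power n′) ⟩
    3 * n′ ^ 4 ∎
    where
    open ≤-Reasoning
    power : ∀ k → (k * k) * (k * k) ≡ k * (k * (k * (k * 1)))
    power = solve-∀

  -- The deficit n⁴/2 - 24 e(H) is multiplied by 3 in `∑⁴-w-bound` and by 7 in the averaging, hence
  -- 21. The inequality is doubled and written without subtraction.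
  stable-partition : ∃ λ V →
    2 * (24 * incorrect4Sets H V) + 21 * (2 * (24 * e H)) ≤ 21 * n′ ^ 4
  stable-partition = part x , (begin
    2 * (24 * incorrect4Sets H (part x)) + 21 * (2 * X)
      ≤⟨ +-monoˡ-≤ (21 * (2 * X)) (*-monoʳ-≤ 2 (≤-trans (incorrect-count H (part x)) small)) ⟩
    2 * (7 * ∑⁴ w) + 21 * (2 * X)
      ≡⟨ regroup (∑⁴ w) X ⟩
    7 * (2 * (∑⁴ w + 3 * X))
      ≤⟨ *-monoʳ-≤ 7 ∑⁴-w-bound ⟩
    7 * (3 * n′ ^ 4)
      ≡⟨ *-assoc 7 3 (n′ ^ 4) ⟨
    21 * n′ ^ 4 ∎)
    where
    open ≤-Reasoning
    X : ℕ
    X = 24 * e H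
    below-average : ∃ λ x → deviation x ≤ 7 * ∑⁴ w
    below-average = ∃-≤-average m deviation (7 * ∑⁴ w) (*-cancelˡ-≤ n′ ∑-deviation)
    x : Fin n′
    x = proj₁ below-average
    small : deviation x ≤ 7 * ∑⁴ w
    small = proj₂ below-average
    regroup : ∀ w X → 2 * (7 * w) + 21 * (2 * X) ≡ 7 * (2 * (w + 3 * X))
    regroup = solve-∀

nonempty-stable-partition : (H : Hypergraph 4 n) → ¬ Contains H 𝓒₃⁽⁴⁾ → 1 ≤ n →
  ∃ λ V → 2 * (24 * incorrect4Sets H V) + 21 * (2 * (24 * e H)) ≤ 21 * n ^ 4
nonempty-stable-partition {suc m} H C-free _ = stable-partition m H C-free

-- Rational bounds in integer form.

open import Data.Integer as ℤ using (+_)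

toℚᵘ-fromℕ : ∀ n → toℚᵘ (fromℕ n) ≡ mkℚᵘ (+ n) 0
toℚᵘ-fromℕ n = cong toℚᵘ (ℚ.normalize-coprime (Coprime.sym (Coprime.1-coprimeTo n)))

toℚᵘ-*-fromℕ : ∀ p n → toℚᵘ (p ℚ.* fromℕ n) ℚᵘ.≃ toℚᵘ p ℚᵘ.* mkℚᵘ (+ n) 0
toℚᵘ-*-fromℕ p n = subst (λ r → toℚᵘ (p ℚ.* fromℕ n) ℚᵘ.≃ toℚᵘ p ℚᵘ.* r) (toℚᵘ-fromℕ n)
  (ℚ.toℚᵘ-homo-* p (fromℕ n))

-- 1 / (d + 1), as in the representation of denominators in mkℚ.
unitFraction : ℕ → ℚ
unitFraction d = mkℚ (+ 1) d (Coprime.1-coprimeTo (suc d))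

-- The numerator of a positive p is at least 1, so p is at least the unit fraction with the same
-- denominator. This reduces ε to the form 1/q.
≤-*-fromℕ : ∀ p .{{_ : ℚ.Positive p}} {i N} → ℚ.↧ₙ p * i ≤ N → fromℕ i ℚ.≤ p ℚ.* fromℕ N
≤-*-fromℕ p@(mkℚ (+ suc m) d _) {i} {N} le = ℚ.toℚᵘ-cancel-≤ (ℚᵘ.≤-respʳ-≃
  (ℚᵘ.≃-sym (toℚᵘ-*-fromℕ p N))
  (subst (ℚᵘ._≤ mkℚᵘ (+ suc m) d ℚᵘ.* mkℚᵘ (+ N) 0) (sym (toℚᵘ-fromℕ i)) (*≤* (begin
    + i ℤ.* + (suc d * 1)              ≡⟨ ℤ.pos-* i (suc d * 1) ⟨
    + (i * (suc d * 1))                ≤⟨ ℤ.+≤+ le′ ⟩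
    + (suc m * N * 1)                  ≡⟨ ℤ.pos-* (suc m * N) 1 ⟩
    + (suc m * N) ℤ.* + 1              ≡⟨ cong (ℤ._* + 1) (ℤ.pos-* (suc m) N) ⟩
    (+ suc m ℤ.* + N) ℤ.* + 1          ∎))))
  where
  open ℤ.≤-Reasoning
  le′ : i * (suc d * 1) ≤ suc m * N * 1
  le′ = ≤-trans (≤-reflexive (trans (cong (i *_) (*-identityʳ (suc d))) (*-comm i (suc d))))
    (≤-trans le (≤-trans (m≤m+n N (m * N)) (≤-reflexive (sym (*-identityʳ (suc m * N))))))

-‿cancel-< : ∀ x y z → x ℚ.- y ℚ.< z → x ℚ.< z ℚ.+ y
-‿cancel-< x y z lt = subst (ℚ._< z ℚ.+ y)
  (trans (ℚ.+-assoc x (ℚ.- y) y) (trans (cong (x ℚ.+_) (ℚ.+-inverseˡ y)) (ℚ.+-identityʳ x)))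
  (ℚ.+-monoˡ-< y lt)

clear-denominator : ∀ k x y N → fromℕ x ℚ.> fromℕ y ℚ.- unitFraction k ℚ.* fromℕ N →
  suc k * y ≤ suc k * x + N
clear-denominator k x y N gt = <⇒≤ (begin-strict
  suc k * y                                    ≡⟨ lhs (suc k) y ⟩
  y * (1 * (suc k * 1))                        <⟨ ℤ.drop‿+<+ cross ⟩
  (x * (suc k * 1) + 1 * N * 1) * 1            ≡⟨ rhs (suc k) x N ⟩
  suc k * x + N                                ∎)
  where
  open ≤-Reasoning
  -- The factors 1 come from the numerators and denominators of the unnormalised fractions.
  lhs : ∀ k y → k * y ≡ y * (1 * (k * 1))
  lhs = solve-∀
  rhs : ∀ k x N → (x * (k * 1) + 1 * N * 1) * 1 ≡ k * x + N
  rhs = solve-∀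
  sum : ℚᵘ
  sum = mkℚᵘ (+ x) 0 ℚᵘ.+ mkℚᵘ (+ 1) k ℚᵘ.* mkℚᵘ (+ N) 0
  sum≃ : toℚᵘ (fromℕ x ℚ.+ unitFraction k ℚ.* fromℕ N) ℚᵘ.≃ sum
  sum≃ = ℚᵘ.≃-trans (ℚ.toℚᵘ-homo-+ (fromℕ x) (unitFraction k ℚ.* fromℕ N))
    (ℚᵘ.+-cong (ℚᵘ.≃-reflexive (toℚᵘ-fromℕ x)) (toℚᵘ-*-fromℕ (unitFraction k) N))
  y<sum : mkℚᵘ (+ y) 0 ℚᵘ.< sum
  y<sum = subst (ℚᵘ._< sum) (toℚᵘ-fromℕ y)
    (ℚᵘ.<-respʳ-≃ sum≃ (ℚ.toℚᵘ-mono-< (-‿cancel-< (fromℕ y) _ (fromℕ x) gt)))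
  cross : + (y * (1 * (suc k * 1))) ℤ.< + ((x * (suc k * 1) + 1 * N * 1) * 1)
  cross = subst₂ ℤ._<_
    (sym (ℤ.pos-* y (1 * (suc k * 1))))
    (trans (cong (ℤ._* + 1) (trans
      (cong₂ ℤ._+_ (sym (ℤ.pos-* x (suc k * 1)))
        (trans (cong (ℤ._* + 1) (sym (ℤ.pos-* 1 N))) (sym (ℤ.pos-* (1 * N) 1))))
      (sym (ℤ.pos-+ (x * (suc k * 1)) (1 * N * 1)))))
      (sym (ℤ.pos-* (x * (suc k * 1) + 1 * N * 1) 1)))
    (ℚᵘ.drop-*<* y<sum)

-- Combining the bounds and choosing the constants.

-- Here n stands for the cube of the number of vertices, N for its fourth power, and I, X, Y for 24
-- times the numbers of incorrect sets, of edges of H and b. Replacing N by the lower bound for Y in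
-- the stability inequality leaves 42 q (Y - X), which `dense` bounds by 42 N, and a cubic error.
combine-bounds : ∀ {q n N I X Y} →
  2 * I + 21 * (2 * X) ≤ 21 * N → N ≤ 2 * Y + (12 * n + 1) →
  q * Y ≤ q * X + N → 46 * (q * n) ≤ N → 1 ≤ n → q * I ≤ 24 * N
combine-bounds {q} {n} {N} {I} {X} {Y} stable lower dense large 1≤n =
  *-cancelˡ-≤ 2 (+-cancelʳ-≤ (2 * (21 * (q * X))) (2 * (q * I)) (2 * (24 * N)) (begin
    2 * (q * I) + 2 * (21 * (q * X))             ≡⟨ eq₁ 21 q I X ⟩
    q * (2 * I + 21 * (2 * X))                   ≤⟨ *-monoʳ-≤ q stable ⟩
    q * (21 * N)                                 ≤⟨ *-monoʳ-≤ q (*-monoʳ-≤ 21 (≤-trans lower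
                                                      (+-monoʳ-≤ (2 * Y)
                                                        (+-monoʳ-≤ (12 * n) 1≤n)))) ⟩
    q * (21 * (2 * Y + (12 * n + n)))            ≡⟨ eq₂ 21 q Y n ⟩
    -- The cubic coefficient 21 * 13 = 273 is rounded up to 276 = 6 * 46, so that `large` turns the
    -- error into 6 N. Together with 42 N this is 48 N = 2 * 24 N.
    2 * 21 * (q * Y) + 21 * 13 * (q * n)         ≤⟨ +-mono-≤ (*-monoʳ-≤ (2 * 21) dense)
                                                      (*-monoˡ-≤ (q * n) (m≤m+n (21 * 13) 3)) ⟩
    2 * 21 * (q * X + N) + 6 * 46 * (q * n)      ≡⟨ cong (λ t → 2 * 21 * (q * X + N) + t)
                                                      (*-assoc 6 46 (q * n)) ⟩
    2 * 21 * (q * X + N) + 6 * (46 * (q * n))    ≤⟨ +-monoʳ-≤ (2 * 21 * (q * X + N))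
                                                      (*-monoʳ-≤ 6 large) ⟩
    2 * 21 * (q * X + N) + 6 * N                 ≡⟨ eq₃ 21 (q * X) N ⟩
    2 * ((21 + 3) * N) + 2 * (21 * (q * X))      ∎))
  where
  open ≤-Reasoning
  eq₁ : ∀ c q I X → 2 * (q * I) + 2 * (c * (q * X)) ≡ q * (2 * I + c * (2 * X))
  eq₁ = solve-∀
  eq₂ : ∀ c q Y n → q * (c * (2 * Y + (12 * n + n))) ≡ 2 * c * (q * Y) + c * 13 * (q * n)
  eq₂ = solve-∀
  eq₃ : ∀ c Z N → 2 * c * (Z + N) + 6 * N ≡ 2 * ((c + 3) * N) + 2 * (c * Z)
  eq₃ = solve-∀

incorrect-bound : ∀ {q n N i x y} →
  2 * (24 * i) + 21 * (2 * (24 * x)) ≤ 21 * N → N ≤ 48 * y + (12 * n + 1) →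
  24 * q * y ≤ 24 * q * x + N → 46 * (q * n) ≤ N → 1 ≤ n → q * i ≤ N
incorrect-bound {q} {n} {N} {i} {x} {y} stable lower dense large 1≤n =
  *-cancelˡ-≤ 24 (≤-trans (≤-reflexive (swap-factors i))
    (combine-bounds {q} {n} {N} {24 * i} {24 * x} {24 * y} stable lower′ dense′ large 1≤n))
  where
  swap-factors : ∀ x → 24 * (q * x) ≡ q * (24 * x)
  swap-factors x = trans (sym (*-assoc 24 q x)) (trans (cong (_* x) (*-comm 24 q)) (*-assoc q 24 x))
  lower′ : N ≤ 2 * (24 * y) + (12 * n + 1)
  lower′ = ≤-trans lower (≤-reflexive (cong (_+ (12 * n + 1)) (*-assoc 2 24 y)))
  dense′ : q * (24 * y) ≤ q * (24 * x) + N
  dense′ = subst₂ (λ x y → x ≤ y + N)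
    (trans (*-assoc 24 q y) (swap-factors y)) (trans (*-assoc 24 q x) (swap-factors x)) dense

-- The theorem for ε = 1/q, with η = 1/(24q) and threshold 46q, after clearing denominators.
stability : ∀ q n (H : Hypergraph 4 n) → ¬ Contains H 𝓒₃⁽⁴⁾ → 1 ≤ n → 46 * q ≤ n →
  24 * q * b n ≤ 24 * q * e H + n ^ 4 → ∃ λ V → q * incorrect4Sets H V ≤ n ^ 4
stability q n H C-free 1≤n 46q≤n dense = proj₁ stable ,
  incorrect-bound {q} {n³} {n ^ 4} {incorrect4Sets H (proj₁ stable)} {e H} {b n}
    (proj₂ stable) (b-lower-bound n) dense large (*-mono-≤ 1≤n (*-mono-≤ 1≤n 1≤n))
  where
  stable : ∃ λ V → 2 * (24 * incorrect4Sets H V) + 21 * (2 * (24 * e H)) ≤ 21 * n ^ 4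
  stable = nonempty-stable-partition H C-free 1≤n
  n³ : ℕ
  n³ = n * (n * n)
  large : 46 * (q * n³) ≤ n ^ 4
  large = ≤-trans (≤-reflexive (sym (*-assoc 46 q n³))) (≤-trans (*-monoˡ-≤ n³ 46q≤n)
    (≤-reflexive (cong (λ k → n * (n * (n * k))) (sym (*-identityʳ n)))))

theorem3 : ∀ (ε : ℚ) → ε ℚ.> 0ℚ →
    Σ[ η ∈ ℚ ] (η ℚ.> 0ℚ ×
    Σ[ n₀ ∈ ℕ ] (∀ (n : ℕ) → n₀ ≤ n → (H : Hypergraph 4 n) →
    ¬ Contains H 𝓒₃⁽⁴⁾ →
    fromℕ (e H) ℚ.> fromℕ (b n) ℚ.- η ℚ.* fromℕ (n ^ 4) →
    Σ[ V₁ ∈ Subset n ] (fromℕ (incorrect4Sets H V₁) ℚ.≤ ε ℚ.* fromℕ (n ^ 4))))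
theorem3 ε ε>0 = unitFraction k , ℚ.positive⁻¹ (unitFraction k) , 46 * q , λ n n₀≤n H C-free dense →
  -- The threshold 46q makes the cubic error terms small against n⁴; since q is positive, it also
  -- ensures that there is a vertex.
  let V , few-incorrect = stability q n H C-free (≤-trans (s≤s z≤n) n₀≤n) n₀≤n
        (subst (λ K → K * b n ≤ K * e H + n ^ 4) 1+k≡24q
          (clear-denominator k (e H) (b n) (n ^ 4) dense))
  in V , ≤-*-fromℕ ε {{ℚ.positive ε>0}} few-incorrect
  where
  q k : ℕ
  q = ℚ.↧ₙ ε
  -- This is 24q - 1, so that η = 1/(24q); the 24 matches the passage from sets to ordered
  -- quadruples. In this form `suc k` computes to `24 * q`.
  k = ℚ.denominator-1 ε + 23 * q
  1+k≡24q : suc k ≡ 24 * q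
  1+k≡24q = refl
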